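{- Fix constants $0<\alpha<1$ and $K_0>0$, and let $\varepsilon,\varepsilon_1>0$ be arbitrary constants. Then there exists a constant $C=C(\varepsilon,\varepsilon_1)$ such that the following holds for all sufficiently large $r$ and $\kappa$. Let $\mathcal{H}$ be a hypergraph on a finite vertex set $X$ which is $\kappa$-spread, $r$-uniform and edge transitive, and which satisfies $$f_{t,A}\le \left(\frac{K_0}{\kappa}\right)^t|\mathcal{H}|\quad\text{for all }A\in\mathcal{H}\text{ and all integers }1\le t\le \alpha r.$$ Let each element of $X$ be colored independently and uniformly at random from $Q=[q]$, where $q\ge (1+\varepsilon_1)r$, and let $X_m^*$ denote a uniformly random $m$-subset of $X$ (chosen independently of the coloring) together with its colors. Then $$m\ge \frac{C|X|}{\kappa}\ \text{ implies }\ \mathbb{P}\big(X_m^*\text{ contains a rainbow colored edge of }\mathcal{H}\big)\ge 1-\varepsilon.$$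
   Context: A hypergraph $\mathcal{H}=\{A_1,\dots,A_M\}$ on vertex set $X$ is a family of subsets of $X$. For $S\subseteq X$, let $\langle S\rangle=\{T: S\subseteq T\subseteq X\}$. $\mathcal{H}$ is $\kappa$-spread if $|\mathcal{H}\cap\langle S\rangle|\le |\mathcal{H}|/\kappa^{|S|}$ for all $S\subseteq X$. $\mathcal{H}$ is $r$-uniform if $|A|=r$ for all $A\in\mathcal{H}$. $\mathcal{H}$ is edge transitive if for every pair of edges $A_i,A_j$ there is a permutation $\pi:X\to X$ with $\pi(A_i)=A_j$ and $\pi(A)\in\mathcal{H}$ for all $A\in\mathcal{H}$. For $A\in\mathcal{H}$ and integer $t$, $f_{t,A}=|\{B\in\mathcal{H}: |B\cap A|=t\}|$. A set of colored elements is rainbow colored if all its elements receive distinct colors. The constants $\alpha,K_0$ do not depend on $r$.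
   Formalization: The constants α, K₀, ε, ε₁ and the spread parameter κ are taken to be rational numbers rather than real numbers. -}

module Defs where

open import Data.Bool using (Bool; true; false; _∧_; _∨_; not; if_then_else_)
open import Data.Nat using (ℕ; zero; suc; _≡ᵇ_)
open import Data.Fin using (Fin; _≟_)
open import Data.Fin.Subset using (Subset; ∣_∣; _∩_)
open import Data.Fin.Permutation using (Permutation′; _⟨$⟩ˡ_)
open import Data.List using (List; []; _∷_; map; concatMap; length; filterᵇ; allFin; cartesianProduct)
open import Data.Bool.ListAction using (all; any)
open import Data.List.Membership.Propositional using (_∈_)
open import Data.Vec using (Vec; []; _∷_; lookup; tabulate)
open import Data.Product using (Σ; _×_; _,_; proj₁; proj₂)
open import Data.Integer using (+_)
open import Data.Rational using (ℚ; _/_; _*_; 1ℚ)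
open import Data.Rational using () renaming (_≤_ to _≤ℚ_)
open import Relation.Nullary.Decidable using (⌊_⌋)
open import Relation.Binary.PropositionalEquality using (_≡_)

toℚ : ℕ → ℚ
toℚ n = (+ n) / 1

infixr 8 _^_
_^_ : ℚ → ℕ → ℚ
x ^ zero = 1ℚ
x ^ suc k = x * (x ^ k)

-- Vertex set X = Fin n.  A hypergraph is a list of subsets (duplicate-free
-- is imposed separately in the statement).
Hypergraph : ℕ → Set
Hypergraph n = List (Subset n)

allVecs : {A : Set} → List A → (k : ℕ) → List (Vec A k)
allVecs xs zero = [] ∷ []
allVecs xs (suc k) = concatMap (λ x → map (x ∷_) (allVecs xs k)) xs

allSubsets : (n : ℕ) → List (Subset n)
allSubsets n = allVecs (true ∷ false ∷ []) n

mSubsets : (n m : ℕ) → List (Subset n)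
mSubsets n m = filterᵇ (λ S → ∣ S ∣ ≡ᵇ m) (allSubsets n)

Coloring : ℕ → ℕ → Set
Coloring n q = Vec (Fin q) n

allColorings : (n q : ℕ) → List (Coloring n q)
allColorings n q = allVecs (allFin q) n

_⊆ᵇ_ : {n : ℕ} → Subset n → Subset n → Bool
_⊆ᵇ_ {n} S T = all (λ i → not (lookup S i) ∨ lookup T i) (allFin n)

countSuper : {n : ℕ} → Hypergraph n → Subset n → ℕ
countSuper H S = length (filterᵇ (λ A → S ⊆ᵇ A) H)

IsSpread : {n : ℕ} → ℚ → Hypergraph n → Set
IsSpread {n} κ H = (S : Subset n) →
  toℚ (countSuper H S) * (κ ^ ∣ S ∣) ≤ℚ toℚ (length H)

IsUniform : {n : ℕ} → ℕ → Hypergraph n → Set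
IsUniform r H = ∀ A → A ∈ H → ∣ A ∣ ≡ r

image : {n : ℕ} → Permutation′ n → Subset n → Subset n
image π A = tabulate (λ j → lookup A (π ⟨$⟩ˡ j))

IsEdgeTransitive : {n : ℕ} → Hypergraph n → Set
IsEdgeTransitive {n} H = ∀ A B → A ∈ H → B ∈ H →
  Σ (Permutation′ n) λ π → (image π A ≡ B) × (∀ C → C ∈ H → image π C ∈ H)

f : {n : ℕ} → Hypergraph n → ℕ → Subset n → ℕ
f H t A = length (filterᵇ (λ B → ∣ B ∩ A ∣ ≡ᵇ t) H)

isRainbowᵇ : {n q : ℕ} → Coloring n q → Subset n → Bool
isRainbowᵇ {n} c A =
  all (λ i → all (λ j → not (lookup A i ∧ lookup A j ∧ not ⌊ i ≟ j ⌋ ∧ ⌊ lookup c i ≟ lookup c j ⌋))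
                 (allFin n))
      (allFin n)

containsRainbowEdgeᵇ : {n q : ℕ} → Hypergraph n → Coloring n q → Subset n → Bool
containsRainbowEdgeᵇ H c S = any (λ A → (A ⊆ᵇ S) ∧ isRainbowᵇ c A) H

-- Sample space: (coloring, m-subset) pairs, uniform (independent product).
-- Number of favourable outcomes:
goodCount : {n : ℕ} → Hypergraph n → (q m : ℕ) → ℕ
goodCount {n} H q m =
  length (filterᵇ (λ p → containsRainbowEdgeᵇ H (proj₁ p) (proj₂ p))
                  (cartesianProduct (allColorings n q) (mSubsets n m)))

totalCount : (n q m : ℕ) → ℕ
totalCount n q m = length (cartesianProduct (allColorings n q) (mSubsets n m))

{-# OPTIONS --safe #-}

-- Second moment method, in counting form.  Let X be the number of rainbow edges inside the
-- random set and N the number of outcomes.  For two edges A, B with |A ∩ B| = t, the number of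
-- outcomes making both of them rainbow and contained is at most (2nL/m)^t times what
-- independence would give: each of the t common vertices saves a factor at most 2n/m for the
-- random set (log-concavity of the binomial coefficients, and m ≥ 2r since κ-spread forces
-- rκ ≤ n) and a factor at most q/(q - r) ≤ L for the colours.  Since
-- f t A ≤ (K/κ)^t |H|, with C = 2LK(e+1) the sum over t is bounded by the geometric series
-- Σ (e+1)^-t = 1 + 1/e, so N Σ X² ≤ (1 + 1/e) (Σ X)², and Cauchy-Schwarz gives
-- X > 0 in all but a fraction 1/e ≤ ε of the outcomes.  For t > αr the bound on f t A follows
-- from spread alone: f t A ≤ 2^r |H| / κ^t, and 2^r ≤ 2^(at) when aα ≥ 1.
module Submission where

open import Data.Bool using (Bool; true; false; _∧_; _∨_; not; T; if_then_else_)
open import Data.List using (List; []; _∷_; _++_; map; concatMap; length; filterᵇ; allFin; cartesianProduct; downFrom)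
open import Data.List.Properties using (map-tabulate; length-tabulate; length-++; length-map; length-filter; map-cong-local; ++-identityʳ)
open import Data.List.Membership.Propositional using (_∈_; _∉_)
open import Data.List.Relation.Unary.Any using (here; there)
open import Data.List.Relation.Unary.Unique.Propositional using (Unique)
open import Data.Fin.Subset using (Subset; ∣_∣; _∩_; _∪_; ∁; ⊥; ⁅_⁆)
open import Data.Fin.Subset.Properties using (∣⊥∣≡0; ∣⁅x⁆∣≡1; ∣p∩q∣≤∣p∣; ∣p∩q∣≤∣q∣; ∩-comm)
open import Data.Product using (Σ; _×_; _,_; proj₁; proj₂)
open import Data.Sum using (inj₁; inj₂; [_,_]′)
open import Function using (_∘_; id)
open import Relation.Binary.PropositionalEquality
  using (_≡_; _≢_; refl; sym; trans; cong; cong₂; subst; subst₂; ≢-sym; module ≡-Reasoning)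
open import Relation.Nullary using (Dec; yes; no; does; ¬_; contradiction)
import Data.Nat.Properties as ℕ
open import Data.Nat.Tactic.RingSolver using (solve-∀)

-- Everything is counted in ℕ, so ratios are cleared beforehand: negative powers such as m^(-t) and
-- (e+1)^(-t), with t the size of an intersection, are multiplied by m^r and (e+1)^r, and the
-- exponents r - t remain. The second moment is bounded for one edge A at a time, by a multiple of
-- the square of `hitCount A`. These bounds add up to a multiple of (Σ X)² only because all the
-- numbers `hitCount A` agree: the count of outcomes that make A rainbow and contained depends on
-- the size of A alone. For unequal counts the sum of the squares would exceed (Σ X)² / |H|.
-- Cauchy-Schwarz enters in linearised form, as a nonnegative square summed over the outcomes, so
-- that no quotient of moments is formed.

module _ where

  open import Defs hiding (_^_)
  open import Data.Bool.ListAction using (all; any; and)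
  open import Data.Bool.Properties using (T?; T-∧)
  open import Data.Empty using (⊥-elim)
  open import Data.Nat hiding (_≟_)
  open import Data.Nat.Properties hiding (_≟_)
  open import Data.Nat.Combinatorics using (_C_; nCk≡nC[n∸k]; nCn≡1; k>n⇒nCk≡0; nCk+nC[k+1]≡[n+1]C[k+1])
  open import Data.Fin using (Fin; zero; suc; _≟_)
  open import Data.List.Membership.Propositional.Properties
    using (∈-filter⁺; ∈-filter⁻; ∈-allFin; ∈-++⁺ˡ; ∈-++⁺ʳ; ∈-++⁻; ∈-downFrom⁺; ∈-downFrom⁻; ∈-concatMap⁺; ∈-map⁺)
  open import Data.List.Relation.Unary.All as All using ([]; _∷_)
  import Data.List.Relation.Unary.All.Properties as All
  open import Data.List.Relation.Unary.AllPairs using ([]; _∷_)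
  open import Data.List.Relation.Unary.Unique.Propositional.Properties using (filter⁺; ++⁺; allFin⁺)
  import Data.List.Relation.Unary.Unique.DecPropositional as DecUnique
  open import Data.Vec using (Vec; []; _∷_; lookup; _[_]≔_)
  open import Data.Vec.Properties using (lookup∘update; lookup∘update′; lookup-zipWith; lookup-map)
  open import Function.Bundles using (mk⇔; Equivalence)
  open import Relation.Nullary.Decidable using (does-⇔; dec-true; ⌊_⌋; ¬?)

  private variable
    n q   : ℕ
    A B K : Set

  -- Finite sums over lists

  ∑ : List A → (A → ℕ) → ℕ
  ∑ []       g = 0
  ∑ (x ∷ xs) g = g x + ∑ xs g

  ⟦_⟧ : Bool → ℕ
  ⟦ b ⟧ = if b then 1 else 0

  ⟦⟧-∧ : ∀ a b → ⟦ a ∧ b ⟧ ≡ ⟦ a ⟧ * ⟦ b ⟧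
  ⟦⟧-∧ false b = refl
  ⟦⟧-∧ true  b = sym (+-identityʳ ⟦ b ⟧)

  ⟦⟧≤1 : ∀ b → ⟦ b ⟧ ≤ 1
  ⟦⟧≤1 false = z≤n
  ⟦⟧≤1 true  = s≤s z≤n

  ∑-mono-∈ : (xs : List A) {g h : A → ℕ} → (∀ x → x ∈ xs → g x ≤ h x) → ∑ xs g ≤ ∑ xs h
  ∑-mono-∈ []       g≤h = z≤n
  ∑-mono-∈ (x ∷ xs) g≤h = +-mono-≤ (g≤h x (here refl)) (∑-mono-∈ xs (λ y y∈xs → g≤h y (there y∈xs)))

  ∑-mono : (xs : List A) {g h : A → ℕ} → (∀ x → g x ≤ h x) → ∑ xs g ≤ ∑ xs h
  ∑-mono xs g≤h = ∑-mono-∈ xs (λ x _ → g≤h x)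

  ∑-cong-∈ : (xs : List A) {g h : A → ℕ} → (∀ x → x ∈ xs → g x ≡ h x) → ∑ xs g ≡ ∑ xs h
  ∑-cong-∈ []       g≡h = refl
  ∑-cong-∈ (x ∷ xs) g≡h = cong₂ _+_ (g≡h x (here refl)) (∑-cong-∈ xs (λ y y∈xs → g≡h y (there y∈xs)))

  ∑-cong : (xs : List A) {g h : A → ℕ} → (∀ x → g x ≡ h x) → ∑ xs g ≡ ∑ xs h
  ∑-cong xs g≡h = ∑-cong-∈ xs (λ x _ → g≡h x)

  ∑-+ : (xs : List A) (g h : A → ℕ) → ∑ xs (λ x → g x + h x) ≡ ∑ xs g + ∑ xs h
  ∑-+ []       g h = refl
  ∑-+ (x ∷ xs) g h rewrite ∑-+ xs g h = interchange (g x) (h x) (∑ xs g) (∑ xs h)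
    where
    interchange : ∀ a b c d → a + b + (c + d) ≡ a + c + (b + d)
    interchange = solve-∀

  ∑-*ˡ : (xs : List A) (k : ℕ) (g : A → ℕ) → ∑ xs (λ x → k * g x) ≡ k * ∑ xs g
  ∑-*ˡ []       k g = sym (*-zeroʳ k)
  ∑-*ˡ (x ∷ xs) k g rewrite ∑-*ˡ xs k g = sym (*-distribˡ-+ k (g x) (∑ xs g))

  ∑-*ʳ : (xs : List A) (g : A → ℕ) (k : ℕ) → ∑ xs (λ x → g x * k) ≡ ∑ xs g * k
  ∑-*ʳ xs g k = trans (∑-cong xs (λ x → *-comm (g x) k)) (trans (∑-*ˡ xs k g) (*-comm k (∑ xs g)))

  ∑-const : (xs : List A) (k : ℕ) → ∑ xs (λ _ → k) ≡ length xs * k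
  ∑-const []       k = refl
  ∑-const (x ∷ xs) k = cong (k +_) (∑-const xs k)

  ∑-0 : (xs : List A) → ∑ xs (λ _ → 0) ≡ 0
  ∑-0 xs = trans (∑-const xs 0) (*-zeroʳ (length xs))

  ∑-swap : (xs : List A) (ys : List B) (g : A → B → ℕ) →
    ∑ xs (λ x → ∑ ys (g x)) ≡ ∑ ys (λ y → ∑ xs (λ x → g x y))
  ∑-swap []       ys g = sym (∑-0 ys)
  ∑-swap (x ∷ xs) ys g rewrite ∑-swap xs ys g = sym (∑-+ ys (g x) (λ y → ∑ xs (λ x′ → g x′ y)))

  ∑-++ : (xs ys : List A) (g : A → ℕ) → ∑ (xs ++ ys) g ≡ ∑ xs g + ∑ ys g
  ∑-++ []       ys g = refl
  ∑-++ (x ∷ xs) ys g rewrite ∑-++ xs ys g = sym (+-assoc (g x) (∑ xs g) (∑ ys g))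

  ∑-map : (h : A → B) (xs : List A) (g : B → ℕ) → ∑ (map h xs) g ≡ ∑ xs (g ∘ h)
  ∑-map h []       g = refl
  ∑-map h (x ∷ xs) g = cong (g (h x) +_) (∑-map h xs g)

  ∑-cartesianProduct : (xs : List A) (ys : List B) {g : A × B → ℕ} →
    ∑ (cartesianProduct xs ys) g ≡ ∑ xs (λ x → ∑ ys (λ y → g (x , y)))
  ∑-cartesianProduct []       ys = refl
  ∑-cartesianProduct (x ∷ xs) ys {g} = trans (∑-++ (map (x ,_) ys) _ g)
    (cong₂ _+_ (∑-map (x ,_) ys g) (∑-cartesianProduct xs ys))

  ∑-concatMap : (h : A → List B) (xs : List A) (g : B → ℕ) →
    ∑ (concatMap h xs) g ≡ ∑ xs (λ x → ∑ (h x) g)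
  ∑-concatMap h []       g = refl
  ∑-concatMap h (x ∷ xs) g = trans (∑-++ (h x) _ g) (cong (∑ (h x) g +_) (∑-concatMap h xs g))

  ∑-allVecs-suc : (xs : List A) (k : ℕ) (g : Vec A (suc k) → ℕ) →
    ∑ (allVecs xs (suc k)) g ≡ ∑ xs (λ x → ∑ (allVecs xs k) (λ v → g (x ∷ v)))
  ∑-allVecs-suc xs k g = trans (∑-concatMap (λ x → map (x ∷_) (allVecs xs k)) xs g)
    (∑-cong xs (λ x → ∑-map (x ∷_) (allVecs xs k) g))

  ∑-filterᵇ : (p : A → Bool) (xs : List A) (g : A → ℕ) → ∑ (filterᵇ p xs) g ≡ ∑ xs (λ x → ⟦ p x ⟧ * g x)
  ∑-filterᵇ p []       g = refl
  ∑-filterᵇ p (x ∷ xs) g with p x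
  ... | true  = cong₂ _+_ (sym (+-identityʳ (g x))) (∑-filterᵇ p xs g)
  ... | false = ∑-filterᵇ p xs g

  length≡∑ : (xs : List A) → length xs ≡ ∑ xs (λ _ → 1)
  length≡∑ xs = sym (trans (∑-const xs 1) (*-identityʳ (length xs)))

  length-filterᵇ : (p : A → Bool) (xs : List A) → length (filterᵇ p xs) ≡ ∑ xs (λ x → ⟦ p x ⟧)
  length-filterᵇ p xs = trans (length≡∑ (filterᵇ p xs))
    (trans (∑-filterᵇ p xs (λ _ → 1)) (∑-cong xs (λ x → *-identityʳ ⟦ p x ⟧)))

  ∈⇒≤∑ : {x : A} {xs : List A} (g : A → ℕ) → x ∈ xs → g x ≤ ∑ xs g
  ∈⇒≤∑ g (here refl)  = m≤m+n _ _
  ∈⇒≤∑ g (there x∈xs) = m≤n⇒m≤o+n _ (∈⇒≤∑ g x∈xs)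

  ∑-allFin-suc : ∀ {n} (g : Fin (suc n) → ℕ) → ∑ (allFin (suc n)) g ≡ g zero + ∑ (allFin n) (g ∘ suc)
  ∑-allFin-suc {n} g = cong (g zero +_)
    (trans (cong (λ xs → ∑ xs g) (sym (map-tabulate id suc))) (∑-map suc (allFin n) g))

  all-allFin-suc : ∀ {n} (p : Fin (suc n) → Bool) → all p (allFin (suc n)) ≡ p zero ∧ all (p ∘ suc) (allFin n)
  all-allFin-suc p = cong (λ bs → p zero ∧ and bs) (trans (map-tabulate suc p) (sym (map-tabulate id (p ∘ suc))))

  -- Subsets containing a given set

  ⊆ᵇ-∷ : ∀ a b (U S : Subset n) → ((a ∷ U) ⊆ᵇ (b ∷ S)) ≡ (not a ∨ b) ∧ (U ⊆ᵇ S)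
  ⊆ᵇ-∷ a b U S = all-allFin-suc (λ i → not (lookup (a ∷ U) i) ∨ lookup (b ∷ S) i)

  ⊥-⊆ᵇ : (S : Subset n) → (⊥ ⊆ᵇ S) ≡ true
  ⊥-⊆ᵇ []      = refl
  ⊥-⊆ᵇ (b ∷ S) = trans (⊆ᵇ-∷ false b ⊥ S) (⊥-⊆ᵇ S)

  ∪-⊆ᵇ : (U V S : Subset n) → ((U ∪ V) ⊆ᵇ S) ≡ (U ⊆ᵇ S) ∧ (V ⊆ᵇ S)
  ∪-⊆ᵇ [] [] [] = refl
  ∪-⊆ᵇ (a ∷ U) (b ∷ V) (c ∷ S)
    rewrite ⊆ᵇ-∷ (a ∨ b) c (U ∪ V) S | ⊆ᵇ-∷ a c U S | ⊆ᵇ-∷ b c V S | ∪-⊆ᵇ U V S = lemma a b c (U ⊆ᵇ S) (V ⊆ᵇ S)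
    where
    lemma : ∀ a b c x y → (not (a ∨ b) ∨ c) ∧ (x ∧ y) ≡ ((not a ∨ c) ∧ x) ∧ ((not b ∨ c) ∧ y)
    lemma false false c     x     y = refl
    lemma false true  false false y = refl
    lemma false true  false true  y = refl
    lemma false true  true  x     y = refl
    lemma true  b     false x     y = refl
    lemma true  false true  x     y = refl
    lemma true  true  true  x     y = refl

  ∣p∣+∣∁p∣≡n : (S : Subset n) → ∣ S ∣ + ∣ ∁ S ∣ ≡ n
  ∣p∣+∣∁p∣≡n []          = refl
  ∣p∣+∣∁p∣≡n (true  ∷ S) = cong suc (∣p∣+∣∁p∣≡n S)
  ∣p∣+∣∁p∣≡n (false ∷ S) = trans (+-suc ∣ S ∣ ∣ ∁ S ∣) (cong suc (∣p∣+∣∁p∣≡n S))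

  nC0≡1 : ∀ n → n C 0 ≡ 1
  nC0≡1 n = trans (nCk≡nC[n∸k] {0} {n} z≤n) (nCn≡1 n)

  -- Applied to |S| + |∁ S| = n = m + d, this trades the size condition on `S` for one on its
  -- complement. The truth value of `a ℕ.≟ c` computes to `a ≡ᵇ c`, so `does-⇔` applies.
  +-≡⇒≡ᵇ : ∀ {a b c d} → a + b ≡ c + d → (a ≡ᵇ c) ≡ (b ≡ᵇ d)
  +-≡⇒≡ᵇ {a} {b} {c} {d} eq = does-⇔
    (mk⇔ (λ { refl → +-cancelˡ-≡ a b d eq }) (λ { refl → +-cancelʳ-≡ b a c eq }))
    (a ℕ.≟ c) (b ℕ.≟ d)

  -- Induction on the first vertex: one in `U` has to be kept, one outside may be kept or omitted,
  -- which is Pascal's rule. Counting by omitted vertices gives every `U` the same lower index `d`,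
  -- so later comparisons move only the upper index.
  ∑-⊇-∁ : (U : Subset n) (d : ℕ) → ∑ (allSubsets n) (λ S → ⟦ ∣ ∁ S ∣ ≡ᵇ d ⟧ * ⟦ U ⊆ᵇ S ⟧) ≡ ∣ ∁ U ∣ C d
  ∑-⊇-∁ []      zero    = sym (nC0≡1 0)
  ∑-⊇-∁ []      (suc d) = refl
  ∑-⊇-∁ {suc n} (a ∷ U) d
    rewrite ∑-allVecs-suc (true ∷ false ∷ []) n (λ S → ⟦ ∣ ∁ S ∣ ≡ᵇ d ⟧ * ⟦ (a ∷ U) ⊆ᵇ S ⟧)
          | +-identityʳ (∑ (allSubsets n) (λ S → ⟦ ∣ ∁ (false ∷ S) ∣ ≡ᵇ d ⟧ * ⟦ (a ∷ U) ⊆ᵇ (false ∷ S) ⟧))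
    with a | d
  ... | true | d = trans (cong₂ _+_
        (trans (∑-cong (allSubsets n) (λ S → cong (λ b → ⟦ ∣ ∁ S ∣ ≡ᵇ d ⟧ * ⟦ b ⟧) (⊆ᵇ-∷ true true U S))) (∑-⊇-∁ U d))
        (trans (∑-cong (allSubsets n) (λ S → trans (cong (λ b → ⟦ suc ∣ ∁ S ∣ ≡ᵇ d ⟧ * ⟦ b ⟧) (⊆ᵇ-∷ true false U S)) (*-zeroʳ ⟦ suc ∣ ∁ S ∣ ≡ᵇ d ⟧))) (∑-0 (allSubsets n))))
      (+-identityʳ _)
  ... | false | zero = trans (cong₂ _+_
        (trans (∑-cong (allSubsets n) (λ S → cong (λ b → ⟦ ∣ ∁ S ∣ ≡ᵇ 0 ⟧ * ⟦ b ⟧) (⊆ᵇ-∷ false true U S))) (∑-⊇-∁ U 0))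
        (∑-0 (allSubsets n)))
      (trans (+-identityʳ _) (trans (nC0≡1 ∣ ∁ U ∣) (sym (nC0≡1 (suc ∣ ∁ U ∣)))))
  ... | false | suc d = trans (cong₂ _+_
        (trans (∑-cong (allSubsets n) (λ S → cong (λ b → ⟦ ∣ ∁ S ∣ ≡ᵇ suc d ⟧ * ⟦ b ⟧) (⊆ᵇ-∷ false true U S))) (∑-⊇-∁ U (suc d)))
        (trans (∑-cong (allSubsets n) (λ S → cong (λ b → ⟦ ∣ ∁ S ∣ ≡ᵇ d ⟧ * ⟦ b ⟧) (⊆ᵇ-∷ false false U S))) (∑-⊇-∁ U d)))
      (trans (+-comm (∣ ∁ U ∣ C suc d) (∣ ∁ U ∣ C d)) (nCk+nC[k+1]≡[n+1]C[k+1] ∣ ∁ U ∣ d))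

  ∑-⊇ : ∀ {m d} → m + d ≡ n → (U : Subset n) → ∑ (mSubsets n m) (λ S → ⟦ U ⊆ᵇ S ⟧) ≡ ∣ ∁ U ∣ C d
  ∑-⊇ {n} {m} {d} m+d≡n U = trans (∑-filterᵇ (λ S → ∣ S ∣ ≡ᵇ m) (allSubsets n) _)
    (trans (∑-cong (allSubsets n) (λ S → cong (λ b → ⟦ b ⟧ * ⟦ U ⊆ᵇ S ⟧)
        (+-≡⇒≡ᵇ {∣ S ∣} {∣ ∁ S ∣} {m} {d} (trans (∣p∣+∣∁p∣≡n S) (sym m+d≡n)))))
      (∑-⊇-∁ U d))

  -- Inclusion-exclusion, arranged so that no subtraction occurs.
  ∣∁∪∣ : (U V : Subset n) → ∣ ∁ (U ∪ V) ∣ + ∣ U ∣ ≡ ∣ ∁ V ∣ + ∣ V ∩ U ∣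
  ∣∁∪∣ []          []          = refl
  ∣∁∪∣ (true  ∷ U) (true  ∷ V) = trans (+-suc _ ∣ U ∣) (trans (cong suc (∣∁∪∣ U V)) (sym (+-suc _ _)))
  ∣∁∪∣ (true  ∷ U) (false ∷ V) = trans (+-suc _ ∣ U ∣) (cong suc (∣∁∪∣ U V))
  ∣∁∪∣ (false ∷ U) (true  ∷ V) = ∣∁∪∣ U V
  ∣∁∪∣ (false ∷ U) (false ∷ V) = cong suc (∣∁∪∣ U V)

  -- Ratios and log-concavity of binomial coefficients

  -- Absorption, (w + 1 - d) C(w + 1, d) = (w + 1) C(w, d), with the subtraction moved across. Both
  -- sides count d-subsets of w + 1 points with one marked point, which lies inside or outside the
  -- subset.
  *-[1+w]C : ∀ w d → (suc w C d) * suc w ≡ (suc w C d) * d + suc w * (w C d)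
  *-[1+w]C w zero = subst₂ (λ x y → x * suc w ≡ x * 0 + suc w * y) (sym (nC0≡1 (suc w))) (sym (nC0≡1 w)) (lemma w)
    where
    lemma : ∀ w → 1 * suc w ≡ 1 * 0 + suc w * 1
    lemma = solve-∀
  *-[1+w]C zero (suc zero) = refl
  *-[1+w]C zero (suc (suc d)) = refl
  *-[1+w]C (suc w) (suc d) = ih (suc w C d) (suc w C suc d) (w C d) (w C suc d)
      (nCk+nC[k+1]≡[n+1]C[k+1] w d) (*-[1+w]C w d) (*-[1+w]C w (suc d)) (nCk+nC[k+1]≡[n+1]C[k+1] (suc w) d)
    where
    ih : ∀ x y u v → u + v ≡ y → x * suc w ≡ x * d + suc w * u →
      y * suc w ≡ y * suc d + suc w * v → x + y ≡ suc (suc w) C suc d →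
      (suc (suc w) C suc d) * suc (suc w) ≡ (suc (suc w) C suc d) * suc d + suc (suc w) * y
    ih x y u v e₁ e₂ e₃ e₄ rewrite sym e₄ = begin
      (x + y) * suc (suc w)                              ≡⟨ l₁ x y w ⟩
      x * suc w + y * suc w + (x + y)                    ≡⟨ cong₂ (λ a b → a + b + (x + y)) e₂ e₃ ⟩
      x * d + suc w * u + (y * suc d + suc w * v) + (x + y) ≡⟨ l₂ x y w u v d ⟩
      (x + y) * suc d + suc w * (u + v) + y              ≡⟨ cong (λ z → (x + y) * suc d + suc w * z + y) e₁ ⟩
      (x + y) * suc d + suc w * y + y                    ≡⟨ l₃ x y w d ⟩
      (x + y) * suc d + suc (suc w) * y                  ∎
      where
      open ≡-Reasoning
      l₁ : ∀ x y w → (x + y) * suc (suc w) ≡ x * suc w + y * suc w + (x + y)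
      l₁ = solve-∀
      l₂ : ∀ x y w u v d → x * d + suc w * u + (y * suc d + suc w * v) + (x + y) ≡ (x + y) * suc d + suc w * (u + v) + y
      l₂ = solve-∀
      l₃ : ∀ x y w d → (x + y) * suc d + suc w * y + y ≡ (x + y) * suc d + suc (suc w) * y
      l₃ = solve-∀

  C-suc-* : ∀ d p → (suc (d + p) C d) * suc p ≡ suc (d + p) * ((d + p) C d)
  C-suc-* d p = +-cancelˡ-≡ ((suc (d + p) C d) * d) _ _ (trans (lemma (suc (d + p) C d) d p) (*-[1+w]C (d + p) d))
    where
    lemma : ∀ x d p → x * d + x * suc p ≡ x * suc (d + p)
    lemma = solve-∀

  -- The ratio C(y + 1, d) / C(y, d) = 1 + d / (y + 1 - d) decreases in y. With y = d + p and z = d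
  -- + s, absorption turns the claim, multiplied by `suc p * suc s`, into d (p + 1) ≤ d (s + 1).
  C-logconcave-suc : ∀ {y z} d → y ≤ z → (y C d) * (suc z C d) ≤ (suc y C d) * (z C d)
  C-logconcave-suc {y} {z} d y≤z with d ≤? y
  ... | no  d≰y rewrite k>n⇒nCk≡0 (≰⇒> d≰y) = z≤n
  ... | yes d≤y with m≤n⇒∃[o]m+o≡n d≤y | m≤n⇒∃[o]m+o≡n (≤-trans d≤y y≤z)
  ...   | p , refl | s , refl = *-cancelʳ-≤ _ _ (suc p * suc s) (begin
    a * b * (suc p * suc s)               ≡⟨ l₁ a b (suc p) (suc s) ⟩
    a * suc p * (b * suc s)               ≡⟨ cong (a * suc p *_) (C-suc-* d s) ⟩
    a * suc p * (suc (d + s) * c)         ≡⟨ l₂ a p d s c ⟩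
    (d * suc p + suc s * suc p) * (a * c) ≤⟨ *-monoˡ-≤ (a * c) (+-monoˡ-≤ (suc s * suc p)
                                               (*-monoʳ-≤ d (s≤s (+-cancelˡ-≤ d p s y≤z)))) ⟩
    (d * suc s + suc s * suc p) * (a * c) ≡⟨ l₃ a p d s c ⟩
    suc (d + p) * a * (suc s * c)         ≡⟨ cong (_* (suc s * c)) (sym (C-suc-* d p)) ⟩
    e * suc p * (suc s * c)               ≡⟨ l₄ e (suc p) (suc s) c ⟩
    e * c * (suc p * suc s)               ∎)
    where
    open ≤-Reasoning
    a = (d + p) C d
    b = suc (d + s) C d
    c = (d + s) C d
    e = suc (d + p) C d
    l₁ : ∀ a b x y → a * b * (x * y) ≡ a * x * (b * y)
    l₁ = solve-∀
    l₂ : ∀ a p d s c → a * suc p * (suc (d + s) * c) ≡ (d * suc p + suc s * suc p) * (a * c)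
    l₂ = solve-∀
    l₃ : ∀ a p d s c → (d * suc s + suc s * suc p) * (a * c) ≡ suc (d + p) * a * (suc s * c)
    l₃ = solve-∀
    l₄ : ∀ e x y c → e * x * (y * c) ≡ e * c * (x * y)
    l₄ = solve-∀

  C-logconcave : ∀ {y z} d k → y ≤ z → (y C d) * ((k + z) C d) ≤ ((k + y) C d) * (z C d)
  C-logconcave         d zero    y≤z = ≤-refl
  C-logconcave {y} {z} d (suc k) y≤z with m≤n⇒m<n∨m≡n y≤z
  -- The induction raises `y` by one and has to stay below `z`, so equality is treated apart.
  ... | inj₂ refl = ≤-reflexive (*-comm (y C d) _)
  ... | inj₁ y<z  = ≤-trans (C-logconcave-suc d (m≤n⇒m≤o+n k y≤z))
    (≤-trans (C-logconcave d k y<z) (≤-reflexive (cong (λ x → (x C d) * (z C d)) (+-suc k y))))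

  -- Each of the `t` steps from v to v + 1 multiplies C(v, d) by (v + 1) / (v + 1 - d), which is at
  -- most n / p, hence at most 2n / m.
  C-+-bound : ∀ {n m w} d t p → d + p ≤ w → m ≤ p + p → t + w ≤ n →
    ((t + w) C d) * m ^ t ≤ (n + n) ^ t * (w C d)
  C-+-bound {w = w} d zero p _ _ _ = ≤-reflexive (trans (*-identityʳ (w C d)) (sym (+-identityʳ (w C d))))
  C-+-bound {n} {m} {w} d (suc t) p d+p≤w m≤2p t+w<n
    with m≤n⇒∃[o]m+o≡n (≤-trans d+p≤w (m≤n+m w t))
  ... | o , eq = begin
    (suc (t + w) C d) * (m * m ^ t)       ≡⟨ l₁ (suc (t + w) C d) m (m ^ t) ⟩
    (suc (t + w) C d) * m * m ^ t         ≤⟨ *-monoˡ-≤ (m ^ t) step ⟩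
    (n + n) * ((t + w) C d) * m ^ t       ≡⟨ *-assoc (n + n) ((t + w) C d) (m ^ t) ⟩
    (n + n) * (((t + w) C d) * m ^ t)     ≤⟨ *-monoʳ-≤ (n + n) (C-+-bound d t p d+p≤w m≤2p (<⇒≤ t+w<n)) ⟩
    (n + n) * ((n + n) ^ t * (w C d))     ≡⟨ sym (*-assoc (n + n) _ (w C d)) ⟩
    (n + n) ^ suc t * (w C d)             ∎
    where
    open ≤-Reasoning
    l₁ : ∀ a b c → a * (b * c) ≡ a * b * c
    l₁ = solve-∀
    l₂ : ∀ x p → x * (p + p) ≡ x * p + x * p
    l₂ = solve-∀
    l₃ : ∀ n c → n * c + n * c ≡ (n + n) * c
    l₃ = solve-∀
    step : (suc (t + w) C d) * m ≤ (n + n) * ((t + w) C d)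
    step = begin
      x * m                         ≤⟨ *-monoʳ-≤ x m≤2p ⟩
      x * (p + p)                   ≤⟨ *-monoʳ-≤ x (+-mono-≤ p≤ p≤) ⟩
      x * (suc (p + o) + suc (p + o)) ≡⟨ l₂ x (suc (p + o)) ⟩
      x * suc (p + o) + x * suc (p + o) ≡⟨ cong (λ v → v + v) up ⟩
      suc (t + w) * ((t + w) C d) + suc (t + w) * ((t + w) C d)
        ≤⟨ +-mono-≤ (*-monoˡ-≤ _ t+w<n) (*-monoˡ-≤ _ t+w<n) ⟩
      n * ((t + w) C d) + n * ((t + w) C d) ≡⟨ l₃ n _ ⟩
      (n + n) * ((t + w) C d)       ∎
      where
      x = suc (t + w) C d
      p≤ : p ≤ suc (p + o)
      p≤ = m≤n⇒m≤1+n (m≤m+n p o)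
      up : x * suc (p + o) ≡ suc (t + w) * ((t + w) C d)
      up = subst (λ v → (suc v C d) * suc (p + o) ≡ suc v * (v C d)) (trans (sym (+-assoc d p o)) eq) (C-suc-* d (p + o))

  -- In probabilities: P(A ∪ B ⊆ S) ≤ (2n/m)^t P(A ⊆ S)², where `w` vertices lie outside A and `y`
  -- outside A ∪ B. Let k = r - t. Log-concavity moves k from the upper index n to y, so that C(y,
  -- d) C(n, d) is at most C(w, d) C(t + w, d); `C-+-bound` then removes the remaining t.
  C-pair-bound : ∀ {n m d r t w y} → m + d ≡ n → w + r ≡ n → r + r ≤ m → t ≤ r → y + r ≡ w + t →
    (y C d) * (n C d) * m ^ t ≤ (n + n) ^ t * ((w C d) * (w C d))
  C-pair-bound {n} {m} {d} {r} {t} {w} {y} m+d≡n w+r≡n 2r≤m t≤r y+r≡w+t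
    with m≤n⇒∃[o]m+o≡n t≤r | m≤n⇒∃[o]m+o≡n 2r≤m
  ... | k , refl | s , refl = begin
    (y C d) * (n C d) * m ^ t               ≡⟨ cong (λ v → (y C d) * (v C d) * m ^ t) (trans (sym w+r≡n) (l₁ w t k)) ⟩
    (y C d) * ((k + (t + w)) C d) * m ^ t   ≤⟨ *-monoˡ-≤ (m ^ t) (C-logconcave d k y≤) ⟩
    ((k + y) C d) * ((t + w) C d) * m ^ t   ≡⟨ cong (λ v → (v C d) * ((t + w) C d) * m ^ t) k+y≡w ⟩
    (w C d) * ((t + w) C d) * m ^ t         ≡⟨ *-assoc (w C d) _ _ ⟩
    -- The witness for `p` is m - r, since m = 2r + s; the assumption 2r ≤ m is what gives m ≤ 2p.
    (w C d) * (((t + w) C d) * m ^ t)       ≤⟨ *-monoʳ-≤ (w C d) (C-+-bound d t (t + k + s) (≤-reflexive d+p≡w) m≤2p t+w≤n) ⟩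
    (w C d) * ((n + n) ^ t * (w C d))       ≡⟨ l₂ (w C d) ((n + n) ^ t) ⟩
    (n + n) ^ t * ((w C d) * (w C d))       ∎
    where
    open ≤-Reasoning
    l₁ : ∀ w t k → w + (t + k) ≡ k + (t + w)
    l₁ = solve-∀
    l₂ : ∀ x y → x * (y * x) ≡ y * (x * x)
    l₂ = solve-∀
    l₃ : ∀ k y t → k + y + t ≡ y + (t + k)
    l₃ = solve-∀
    l₄ : ∀ d r s → d + (r + s) + r ≡ r + r + s + d
    l₄ = solve-∀
    k+y≡w : k + y ≡ w
    k+y≡w = +-cancelʳ-≡ t (k + y) w (trans (l₃ k y t) y+r≡w+t)
    y≤ : y ≤ t + w
    y≤ = ≤-trans (≤-trans (m≤n+m y k) (≤-reflexive k+y≡w)) (m≤n+m w t)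
    d+p≡w : d + (t + k + s) ≡ w
    d+p≡w = +-cancelʳ-≡ (t + k) _ w (trans (l₄ d (t + k) s) (trans m+d≡n (sym w+r≡n)))
    m≤2p : (t + k) + (t + k) + s ≤ (t + k + s) + (t + k + s)
    m≤2p = ≤-trans (≤-reflexive (+-assoc (t + k) (t + k) s)) (+-monoˡ-≤ _ (m≤m+n (t + k) s))
    t+w≤n : t + w ≤ n
    t+w≤n = ≤-trans (m≤n+m (t + w) k) (≤-reflexive (trans (sym (l₁ w t k)) w+r≡n))

  ∑-⊇-∪-bound : ∀ {m d r} → m + d ≡ n → r + r ≤ m → (U V : Subset n) → ∣ U ∣ ≡ r → ∣ V ∣ ≡ r →
    (∣ ∁ (U ∪ V) ∣ C d) * (n C d) * m ^ ∣ V ∩ U ∣ ≤ (n + n) ^ ∣ V ∩ U ∣ * ((∣ ∁ U ∣ C d) * (∣ ∁ U ∣ C d))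
  ∑-⊇-∪-bound {n} m+d≡n 2r≤m U V refl ∣V∣≡∣U∣ = C-pair-bound m+d≡n
    (trans (+-comm ∣ ∁ U ∣ ∣ U ∣) (∣p∣+∣∁p∣≡n U)) 2r≤m (∣p∩q∣≤∣q∣ V U)
    (trans (∣∁∪∣ U V) (cong (_+ ∣ V ∩ U ∣) (+-cancelˡ-≡ ∣ U ∣ _ _
      (trans (cong (_+ ∣ ∁ V ∣) (sym ∣V∣≡∣U∣)) (trans (∣p∣+∣∁p∣≡n V) (sym (∣p∣+∣∁p∣≡n U)))))))

  C-pos : ∀ {y d} → d ≤ y → 0 < y C d
  C-pos {y}     {zero}  _         = ≤-reflexive (sym (nC0≡1 y))
  C-pos {suc y} {suc d} (s≤s d≤y) = <-≤-trans (C-pos d≤y)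
    (≤-trans (m≤m+n (y C d) _) (≤-reflexive (nCk+nC[k+1]≡[n+1]C[k+1] y d)))

  -- Rainbow colourings

  -- Independence of the colours in counting form: overwriting vertex `i` by each of the `q` colours
  -- produces every colouring exactly `q` times.
  ∑-resample : (n q : ℕ) (F : Coloring n q → ℕ) (i : Fin n) →
    ∑ (allColorings n q) (λ c → ∑ (allFin q) (λ v → F (c [ i ]≔ v))) ≡ q * ∑ (allColorings n q) F
  ∑-resample (suc n) q F zero = begin
    ∑ (allColorings (suc n) q) (λ c → ∑ (allFin q) (λ v → F (c [ zero ]≔ v)))
      ≡⟨ ∑-allVecs-suc (allFin q) n _ ⟩
    ∑ (allFin q) (λ _ → ∑ (allColorings n q) (λ c → ∑ (allFin q) (λ v → F (v ∷ c))))
      ≡⟨ ∑-const (allFin q) _ ⟩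
    length (allFin q) * ∑ (allColorings n q) (λ c → ∑ (allFin q) (λ v → F (v ∷ c)))
      ≡⟨ cong₂ _*_ (length-tabulate {n = q} id) (trans (∑-swap (allColorings n q) (allFin q) _) (sym (∑-allVecs-suc (allFin q) n F))) ⟩
    q * ∑ (allColorings (suc n) q) F ∎
    where open ≡-Reasoning
  ∑-resample (suc n) q F (suc i) = begin
    ∑ (allColorings (suc n) q) (λ c → ∑ (allFin q) (λ v → F (c [ suc i ]≔ v)))
      ≡⟨ ∑-allVecs-suc (allFin q) n _ ⟩
    ∑ (allFin q) (λ x → ∑ (allColorings n q) (λ c → ∑ (allFin q) (λ v → F (x ∷ (c [ i ]≔ v)))))
      ≡⟨ ∑-cong (allFin q) (λ x → ∑-resample n q (λ c → F (x ∷ c)) i) ⟩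
    ∑ (allFin q) (λ x → q * ∑ (allColorings n q) (λ c → F (x ∷ c)))
      ≡⟨ ∑-*ˡ (allFin q) q _ ⟩
    q * ∑ (allFin q) (λ x → ∑ (allColorings n q) (λ c → F (x ∷ c)))
      ≡⟨ cong (q *_) (sym (∑-allVecs-suc (allFin q) n F)) ⟩
    q * ∑ (allColorings (suc n) q) F ∎
    where open ≡-Reasoning

  -- This and `distinct` are read off decision procedures, so that `distinct (v ∷ ws)` reduces to
  -- `fresh v ws ∧ distinct ws` and the link with `Unique` is immediate.
  fresh : Fin q → List (Fin q) → Bool
  fresh v ws = does (All.all? (λ w → ¬? (v ≟ w)) ws)

  distinct : List (Fin q) → Bool
  distinct ws = does (DecUnique.unique? _≟_ ws)

  ∑-does-≟ : (w : Fin q) (g : Fin q → ℕ) → ∑ (allFin q) (λ v → ⟦ does (v ≟ w) ⟧ * g v) ≡ g w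
  ∑-does-≟ {suc q} zero g = trans (∑-allFin-suc (λ v → ⟦ does (v ≟ zero) ⟧ * g v))
    (trans (cong₂ _+_ (+-identityʳ (g zero)) (∑-0 (allFin q))) (+-identityʳ (g zero)))
  ∑-does-≟ {suc q} (suc w) g = trans (∑-allFin-suc (λ v → ⟦ does (v ≟ suc w) ⟧ * g v))
    (∑-does-≟ w (g ∘ suc))

  -- Since `w` does not occur in `ws`, the colours fresh for `ws` are those fresh for `w ∷ ws`
  -- together with `w` itself.
  ∑-fresh : (ws : List (Fin q)) → distinct ws ≡ true → ∑ (allFin q) (λ v → ⟦ fresh v ws ⟧) + length ws ≡ q
  ∑-fresh {q} []       _ = trans (+-identityʳ _) (trans (sym (length≡∑ (allFin q))) (length-tabulate {n = q} id))
  ∑-fresh {q} (w ∷ ws) d with fresh w ws in fr | distinct ws in dist | d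
  ... | false | _     | ()
  ... | true  | false | ()
  ... | true  | true  | _ = begin
    ∑ (allFin q) (λ v → ⟦ not (does (v ≟ w)) ∧ fresh v ws ⟧) + suc (length ws)
      ≡⟨ +-suc _ (length ws) ⟩
    1 + ∑ (allFin q) (λ v → ⟦ not (does (v ≟ w)) ∧ fresh v ws ⟧) + length ws
      ≡⟨ cong (λ b → ⟦ b ⟧ + ∑ (allFin q) (λ v → ⟦ not (does (v ≟ w)) ∧ fresh v ws ⟧) + length ws) (sym fr) ⟩
    ⟦ fresh w ws ⟧ + ∑ (allFin q) (λ v → ⟦ not (does (v ≟ w)) ∧ fresh v ws ⟧) + length ws
      ≡⟨ cong (λ s → s + ∑ (allFin q) (λ v → ⟦ not (does (v ≟ w)) ∧ fresh v ws ⟧) + length ws) (sym (∑-does-≟ w (λ v → ⟦ fresh v ws ⟧))) ⟩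
    ∑ (allFin q) (λ v → ⟦ does (v ≟ w) ⟧ * ⟦ fresh v ws ⟧) + ∑ (allFin q) (λ v → ⟦ not (does (v ≟ w)) ∧ fresh v ws ⟧) + length ws
      ≡⟨ cong (_+ length ws) (sym (∑-+ (allFin q) _ _)) ⟩
    ∑ (allFin q) (λ v → ⟦ does (v ≟ w) ⟧ * ⟦ fresh v ws ⟧ + ⟦ not (does (v ≟ w)) ∧ fresh v ws ⟧) + length ws
      ≡⟨ cong (_+ length ws) (∑-cong (allFin q) (λ v → split (does (v ≟ w)) (fresh v ws))) ⟩
    ∑ (allFin q) (λ v → ⟦ fresh v ws ⟧) + length ws
      ≡⟨ ∑-fresh ws dist ⟩
    q ∎
    where
    open ≡-Reasoning
    split : ∀ a b → ⟦ a ⟧ * ⟦ b ⟧ + ⟦ not a ∧ b ⟧ ≡ ⟦ b ⟧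
    split false b = refl
    split true  b = trans (+-identityʳ _) (+-identityʳ ⟦ b ⟧)

  -- A repetition in `ws` makes both sides zero, so `q ∸ length ws` can stand as a plain factor for
  -- every list.
  ∑-fresh-∧ : (ws : List (Fin q)) →
    ∑ (allFin q) (λ v → ⟦ fresh v ws ∧ distinct ws ⟧) ≡ (q ∸ length ws) * ⟦ distinct ws ⟧
  ∑-fresh-∧ {q} ws = trans (∑-cong (allFin q) (λ v → ⟦⟧-∧ (fresh v ws) (distinct ws)))
    (trans (∑-*ʳ (allFin q) (λ v → ⟦ fresh v ws ⟧) ⟦ distinct ws ⟧) (lemma (distinct ws) refl))
    where
    lemma : ∀ b → distinct ws ≡ b →
      ∑ (allFin q) (λ v → ⟦ fresh v ws ⟧) * ⟦ b ⟧ ≡ (q ∸ length ws) * ⟦ b ⟧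
    lemma false _ = trans (*-zeroʳ (∑ (allFin q) _)) (sym (*-zeroʳ (q ∸ length ws)))
    lemma true  d = cong (_* 1) (trans (sym (m+n∸n≡m _ (length ws))) (cong (_∸ length ws) (∑-fresh ws d)))

  colors : Coloring n q → List (Fin n) → List (Fin q)
  colors c = map (lookup c)

  IndependentOf : Fin n → (Coloring n q → ℕ) → Set
  IndependentOf x P = ∀ c v → P (c [ x ]≔ v) ≡ P c

  colors-update : ∀ {x : Fin n} {zs} (c : Coloring n q) v → x ∉ zs → colors (c [ x ]≔ v) zs ≡ colors c zs
  colors-update {x = x} c v x∉zs = map-cong-local (All.tabulate λ y∈zs → lookup∘update′ (λ { refl → x∉zs y∈zs }) c v)

  -- Resample the colour of `x`: the weight `P` and the colours of `zs` stay the same, so only the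
  -- freshness of the new colour matters.
  ∑-distinct-∷ : (P : Coloring n q → ℕ) (x : Fin n) (zs : List (Fin n)) → x ∉ zs → IndependentOf x P →
    q * ∑ (allColorings n q) (λ c → P c * ⟦ distinct (colors c (x ∷ zs)) ⟧) ≡
    (q ∸ length zs) * ∑ (allColorings n q) (λ c → P c * ⟦ distinct (colors c zs) ⟧)
  ∑-distinct-∷ {n} {q} P x zs x∉zs indep = begin
    q * ∑ (allColorings n q) F
      ≡⟨ sym (∑-resample n q F x) ⟩
    ∑ (allColorings n q) (λ c → ∑ (allFin q) (λ v → F (c [ x ]≔ v)))
      ≡⟨ ∑-cong (allColorings n q) (λ c → ∑-cong (allFin q) (λ v → cong₂ _*_ (indep c v)
           (cong₂ (λ w ws → ⟦ fresh w ws ∧ distinct ws ⟧) (lookup∘update x c v) (colors-update c v x∉zs)))) ⟩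
    ∑ (allColorings n q) (λ c → ∑ (allFin q) (λ v → P c * ⟦ fresh v (colors c zs) ∧ distinct (colors c zs) ⟧))
      ≡⟨ ∑-cong (allColorings n q) inner ⟩
    ∑ (allColorings n q) (λ c → (q ∸ length zs) * (P c * ⟦ distinct (colors c zs) ⟧))
      ≡⟨ ∑-*ˡ (allColorings n q) (q ∸ length zs) _ ⟩
    (q ∸ length zs) * ∑ (allColorings n q) (λ c → P c * ⟦ distinct (colors c zs) ⟧) ∎
    where
    open ≡-Reasoning
    F : Coloring n q → ℕ
    F c = P c * ⟦ distinct (colors c (x ∷ zs)) ⟧
    comm : ∀ p k d → p * (k * d) ≡ k * (p * d)
    comm = solve-∀
    inner : ∀ c → ∑ (allFin q) (λ v → P c * ⟦ fresh v (colors c zs) ∧ distinct (colors c zs) ⟧) ≡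
      (q ∸ length zs) * (P c * ⟦ distinct (colors c zs) ⟧)
    inner c = trans (∑-*ˡ (allFin q) (P c) _)
      (trans (cong (P c *_) (trans (∑-fresh-∧ (colors c zs))
        (cong (λ l → (q ∸ l) * ⟦ distinct (colors c zs) ⟧) (length-map (lookup c) zs))))
      (comm (P c) (q ∸ length zs) _))

  -- The falling factorial of q - a with `k` factors: the ways to colour `k` further vertices once
  -- `a` distinct colours are taken.
  falling : (q a k : ℕ) → ℕ
  falling q a zero    = 1
  falling q a (suc k) = (q ∸ (a + k)) * falling q a k

  -- The weight `P` carries the event that is kept while the vertices of `xs` are coloured: either
  -- the rainbow indicator of an edge that avoids `xs`, or the constant 1.
  ∑-distinct-++ : (P : Coloring n q → ℕ) (xs ys : List (Fin n)) → Unique (xs ++ ys) →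
    (∀ {x} → x ∈ xs → IndependentOf x P) →
    q ^ length xs * ∑ (allColorings n q) (λ c → P c * ⟦ distinct (colors c (xs ++ ys)) ⟧) ≡
    falling q (length ys) (length xs) * ∑ (allColorings n q) (λ c → P c * ⟦ distinct (colors c ys) ⟧)
  ∑-distinct-++ P [] ys u indep = refl
  ∑-distinct-++ {n} {q} P (x ∷ xs) ys (x≢ ∷ u) indep = begin
    q * q ^ length xs * S (x ∷ xs ++ ys)        ≡⟨ l₁ q (q ^ length xs) _ ⟩
    q ^ length xs * (q * S (x ∷ xs ++ ys))
      ≡⟨ cong (q ^ length xs *_) (∑-distinct-∷ P x (xs ++ ys) (λ x∈ → All.lookup x≢ x∈ refl) (indep (here refl))) ⟩
    q ^ length xs * ((q ∸ length (xs ++ ys)) * S (xs ++ ys))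
      ≡⟨ cong (λ l → q ^ length xs * ((q ∸ l) * S (xs ++ ys))) (trans (length-++ xs) (+-comm (length xs) (length ys))) ⟩
    q ^ length xs * ((q ∸ (length ys + length xs)) * S (xs ++ ys))
      ≡⟨ l₂ (q ^ length xs) (q ∸ (length ys + length xs)) (S (xs ++ ys)) ⟩
    (q ∸ (length ys + length xs)) * (q ^ length xs * S (xs ++ ys))
      ≡⟨ cong ((q ∸ (length ys + length xs)) *_) (∑-distinct-++ P xs ys u (indep ∘ there)) ⟩
    (q ∸ (length ys + length xs)) * (falling q (length ys) (length xs) * S ys)
      ≡⟨ sym (*-assoc (q ∸ (length ys + length xs)) (falling q (length ys) (length xs)) (S ys)) ⟩
    falling q (length ys) (suc (length xs)) * S ys ∎
    where
    open ≡-Reasoning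
    S : List (Fin n) → ℕ
    S zs = ∑ (allColorings n q) (λ c → P c * ⟦ distinct (colors c zs) ⟧)
    l₁ : ∀ a b c → a * b * c ≡ b * (a * c)
    l₁ = solve-∀
    l₂ : ∀ a b c → a * (b * c) ≡ b * (a * c)
    l₂ = solve-∀

  -- Rainbow edges as lists of distinct colours

  elements : Subset n → List (Fin n)
  elements {n} U = filterᵇ (lookup U) (allFin n)

  ∈-elements⁺ : (U : Subset n) {i : Fin n} → T (lookup U i) → i ∈ elements U
  ∈-elements⁺ U {i} = ∈-filter⁺ (T? ∘ lookup U) (∈-allFin i)

  ∈-elements⁻ : (U : Subset n) {i : Fin n} → i ∈ elements U → T (lookup U i)
  ∈-elements⁻ {n} U = proj₂ ∘ ∈-filter⁻ (T? ∘ lookup U) {xs = allFin n}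

  elements-unique : (U : Subset n) → Unique (elements U)
  elements-unique {n} U = filter⁺ (T? ∘ lookup U) (allFin⁺ n)

  ∑-lookup : (U : Subset n) → ∑ (allFin n) (λ i → ⟦ lookup U i ⟧) ≡ ∣ U ∣
  ∑-lookup []          = refl
  ∑-lookup (true  ∷ U) = trans (∑-allFin-suc (λ i → ⟦ lookup (true ∷ U) i ⟧)) (cong suc (∑-lookup U))
  ∑-lookup (false ∷ U) = trans (∑-allFin-suc (λ i → ⟦ lookup (false ∷ U) i ⟧)) (∑-lookup U)

  length-elements : (U : Subset n) → length (elements U) ≡ ∣ U ∣
  length-elements {n} U = trans (length-filterᵇ (lookup U) (allFin n)) (∑-lookup U)

  Rainbow : Coloring n q → Subset n → Set
  Rainbow c A = ∀ i j → T (lookup A i) → T (lookup A j) → i ≢ j → lookup c i ≢ lookup c j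

  T-pair⁻ : ∀ {P Q : Set} a b (p? : Dec P) (q? : Dec Q) →
    T (not (a ∧ b ∧ not ⌊ p? ⌋ ∧ ⌊ q? ⌋)) → T a → T b → ¬ P → ¬ Q
  T-pair⁻ true true (yes p) _       _ _ _ ¬p = contradiction p ¬p
  T-pair⁻ true true (no _)  (no ¬q) _ _ _ _  = ¬q

  T-pair⁺ : ∀ {P Q : Set} a b (p? : Dec P) (q? : Dec Q) →
    (T a → T b → ¬ P → ¬ Q) → T (not (a ∧ b ∧ not ⌊ p? ⌋ ∧ ⌊ q? ⌋))
  T-pair⁺ false _     _       _       _ = _
  T-pair⁺ true  false _       _       _ = _
  T-pair⁺ true  true  (yes _) _       _ = _
  T-pair⁺ true  true  (no _)  (no _)  _ = _
  T-pair⁺ true  true  (no ¬p) (yes q) h = h _ _ ¬p q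

  isRainbowᵇ⁻ : (c : Coloring n q) (A : Subset n) → T (isRainbowᵇ c A) → Rainbow c A
  isRainbowᵇ⁻ {n} c A t i j =
    T-pair⁻ (lookup A i) (lookup A j) (i ≟ j) (lookup c i ≟ lookup c j)
      (All.lookup (All.all⁺ _ (allFin n) (All.lookup (All.all⁺ _ (allFin n) t) (∈-allFin i))) (∈-allFin j))

  isRainbowᵇ⁺ : (c : Coloring n q) (A : Subset n) → Rainbow c A → T (isRainbowᵇ c A)
  isRainbowᵇ⁺ {n} c A r = All.all⁻ _ (All.tabulate {xs = allFin n} λ {i} _ →
    All.all⁻ _ (All.tabulate {xs = allFin n} λ {j} _ →
      T-pair⁺ (lookup A i) (lookup A j) (i ≟ j) (lookup c i ≟ lookup c j) (r i j)))

  unique-colors⁺ : (c : Coloring n q) (zs : List (Fin n)) → Unique zs →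
    (∀ i j → i ∈ zs → j ∈ zs → i ≢ j → lookup c i ≢ lookup c j) → Unique (colors c zs)
  unique-colors⁺ c []       []       h = []
  unique-colors⁺ c (x ∷ zs) (x≢ ∷ u) h =
    All.map⁺ (All.tabulate λ {j} j∈ → h x j (here refl) (there j∈) (All.lookup x≢ j∈)) ∷
    unique-colors⁺ c zs u (λ i j i∈ j∈ → h i j (there i∈) (there j∈))

  unique-colors⁻ : (c : Coloring n q) (zs : List (Fin n)) → Unique (colors c zs) →
    ∀ i j → i ∈ zs → j ∈ zs → i ≢ j → lookup c i ≢ lookup c j
  unique-colors⁻ c (x ∷ zs) (x≢ ∷ u) i j (here refl) (here refl) i≢j = contradiction refl i≢j
  unique-colors⁻ c (x ∷ zs) (x≢ ∷ u) i j (here refl) (there j∈)  i≢j = All.lookup (All.map⁻ x≢) j∈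
  unique-colors⁻ c (x ∷ zs) (x≢ ∷ u) i j (there i∈)  (here refl) i≢j = ≢-sym (All.lookup (All.map⁻ x≢) i∈)
  unique-colors⁻ c (x ∷ zs) (x≢ ∷ u) i j (there i∈)  (there j∈)  i≢j = unique-colors⁻ c zs u i j i∈ j∈ i≢j

  Enumerates : List (Fin n) → Subset n → Set
  Enumerates zs A = ∀ i → (i ∈ zs → T (lookup A i)) × (T (lookup A i) → i ∈ zs)

  -- Stated for an arbitrary enumeration, so that an edge can be listed in the order that suits a
  -- second edge.
  isRainbowᵇ≡distinct : (A : Subset n) {zs : List (Fin n)} → Unique zs → Enumerates zs A → (c : Coloring n q) →
    isRainbowᵇ c A ≡ distinct (colors c zs)
  isRainbowᵇ≡distinct A {zs} u enum c = does-⇔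
    (mk⇔ (λ t → unique-colors⁺ c zs u (λ i j i∈ j∈ → isRainbowᵇ⁻ c A t i j (proj₁ (enum i) i∈) (proj₁ (enum j) j∈)))
         (λ t → isRainbowᵇ⁺ c A (λ i j i∈ j∈ → unique-colors⁻ c zs t i j (proj₂ (enum i) i∈) (proj₂ (enum j) j∈))))
    (T? (isRainbowᵇ c A)) (DecUnique.unique? _≟_ (colors c zs))

  elements-enumerates : (A : Subset n) → Enumerates (elements A) A
  elements-enumerates A i = ∈-elements⁻ A , ∈-elements⁺ A

  isRainbowᵇ-independent : (A : Subset n) {x : Fin n} → ¬ T (lookup A x) →
    IndependentOf {n} {q} x (λ c → ⟦ isRainbowᵇ c A ⟧)
  isRainbowᵇ-independent A {x} x∉A c v = cong ⟦_⟧
    (trans (eq (c [ x ]≔ v)) (trans (cong distinct (colors-update c v (x∉A ∘ ∈-elements⁻ A))) (sym (eq c))))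
    where eq = isRainbowᵇ≡distinct A (elements-unique A) (elements-enumerates A)

  lookup-∩ : (B A : Subset n) (i : Fin n) → lookup (B ∩ A) i ≡ lookup B i ∧ lookup A i
  lookup-∩ B A i = lookup-zipWith _∧_ i B A

  module _ (A B : Subset n) where

    -- `B` is listed with its vertices outside `A` first: recolouring these does not affect whether
    -- `A` is rainbow.
    only both : List (Fin n)
    only = elements (B ∩ ∁ A)
    both = elements (B ∩ A)

    ∈-only⇒∉ : ∀ {i} → i ∈ only → ¬ T (lookup A i)
    ∈-only⇒∉ {i} i∈ with lookup A i | lookup B i | subst T (trans (lookup-∩ B (∁ A) i) (cong (lookup B i ∧_) (lookup-map i not A))) (∈-elements⁻ (B ∩ ∁ A) i∈)
    ... | false | _ | _ = λ ()
    ... | true | false | ()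
    ... | true | true | ()

    only-both-unique : Unique (only ++ both)
    only-both-unique = ++⁺ (elements-unique (B ∩ ∁ A)) (elements-unique (B ∩ A))
      λ {i} → λ { (i∈o , i∈b) → ∈-only⇒∉ i∈o (proj₂ (Equivalence.to T-∧ (subst T (lookup-∩ B A i) (∈-elements⁻ (B ∩ A) i∈b)))) }

    only-both-enumerates : Enumerates (only ++ both) B
    only-both-enumerates i = to , from
      where
      left : ∀ (V : Subset n) → i ∈ elements (B ∩ V) → T (lookup B i)
      left V i∈ = proj₁ (Equivalence.to T-∧ (subst T (lookup-∩ B V i) (∈-elements⁻ (B ∩ V) i∈)))
      to : i ∈ only ++ both → T (lookup B i)
      to i∈ = [ left (∁ A) , left A ]′ (∈-++⁻ only i∈)
      put : ∀ (V : Subset n) → T (lookup B i) → T (lookup V i) → i ∈ elements (B ∩ V)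
      put V b v = ∈-elements⁺ (B ∩ V) (subst T (sym (lookup-∩ B V i)) (Equivalence.from T-∧ (b , v)))
      from : T (lookup B i) → i ∈ only ++ both
      from b with T? (lookup A i)
      ... | yes a = ∈-++⁺ʳ only (put A b a)
      ... | no ¬a = ∈-++⁺ˡ (put (∁ A) b (subst T (sym (lookup-map i not A)) (T-not (lookup A i) ¬a)))
        where
        T-not : ∀ x → ¬ T x → T (not x)
        T-not false _ = _
        T-not true  h = ⊥-elim (h _)

  -- Colourings that make one or two edges rainbow

  rainbowCount : (q : ℕ) → Subset n → ℕ
  rainbowCount {n} q A = ∑ (allColorings n q) (λ c → ⟦ isRainbowᵇ c A ⟧)

  rainbowCount₂ : (q : ℕ) → Subset n → Subset n → ℕ
  rainbowCount₂ {n} q A B = ∑ (allColorings n q) (λ c → ⟦ isRainbowᵇ c A ⟧ * ⟦ isRainbowᵇ c B ⟧)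

  length-allVecs : (xs : List A) (k : ℕ) → length (allVecs xs k) ≡ length xs ^ k
  length-allVecs xs zero    = refl
  length-allVecs xs (suc k) = trans (length≡∑ (allVecs xs (suc k))) (trans (∑-allVecs-suc xs k (λ _ → 1))
    (trans (∑-const xs _) (cong (length xs *_) (trans (sym (length≡∑ (allVecs xs k))) (length-allVecs xs k)))))

  length-allColorings : (n q : ℕ) → length (allColorings n q) ≡ q ^ n
  length-allColorings n q = trans (length-allVecs (allFin q) n) (cong (_^ n) (length-tabulate {n = q} id))

  ∑-1*⟦⟧ : (xs : List A) (p : A → Bool) → ∑ xs (λ x → 1 * ⟦ p x ⟧) ≡ ∑ xs (λ x → ⟦ p x ⟧)
  ∑-1*⟦⟧ xs p = ∑-cong xs (λ x → +-identityʳ ⟦ p x ⟧)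

  ∑-distinct : (ys : List (Fin n)) → Unique ys →
    q ^ length ys * ∑ (allColorings n q) (λ c → ⟦ distinct (colors c ys) ⟧) ≡ falling q 0 (length ys) * q ^ n
  ∑-distinct {n} {q} ys u = begin
    q ^ length ys * ∑ (allColorings n q) (λ c → ⟦ distinct (colors c ys) ⟧)
      ≡⟨ cong (q ^ length ys *_) (trans (sym (∑-1*⟦⟧ (allColorings n q) _))
           (cong (λ zs → ∑ (allColorings n q) (λ c → 1 * ⟦ distinct (colors c zs) ⟧)) (sym (++-identityʳ ys)))) ⟩
    q ^ length ys * ∑ (allColorings n q) (λ c → 1 * ⟦ distinct (colors c (ys ++ [])) ⟧)
      ≡⟨ ∑-distinct-++ (λ _ → 1) ys [] (subst Unique (sym (++-identityʳ ys)) u) (λ _ _ _ → refl) ⟩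
    falling q 0 (length ys) * ∑ (allColorings n q) (λ _ → 1)
      ≡⟨ cong (falling q 0 (length ys) *_) (trans (sym (length≡∑ (allColorings n q))) (length-allColorings n q)) ⟩
    falling q 0 (length ys) * q ^ n ∎
    where open ≡-Reasoning

  rainbowCount-falling : (q : ℕ) (A : Subset n) → q ^ ∣ A ∣ * rainbowCount q A ≡ falling q 0 ∣ A ∣ * q ^ n
  rainbowCount-falling {n} q A rewrite sym (length-elements A) = trans
    (cong (q ^ length (elements A) *_) (∑-cong (allColorings n q)
      (λ c → cong ⟦_⟧ (isRainbowᵇ≡distinct A (elements-unique A) (elements-enumerates A) c))))
    (∑-distinct (elements A) (elements-unique A))

  rainbowCount-≡ : (q : ℕ) .{{_ : NonZero q}} {A B : Subset n} → ∣ A ∣ ≡ ∣ B ∣ → rainbowCount q A ≡ rainbowCount q B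
  rainbowCount-≡ {n} q {A} {B} eq = *-cancelˡ-≡ _ _ (q ^ ∣ A ∣) {{m^n≢0 q ∣ A ∣}}
    (trans (rainbowCount-falling q A) (trans (cong (λ a → falling q 0 a * q ^ n) eq)
      (trans (sym (rainbowCount-falling q B)) (cong (λ a → q ^ a * rainbowCount q B) (sym eq)))))

  rainbowCount-pos : (q : ℕ) (A : Subset n) → ∣ A ∣ < q → 0 < rainbowCount q A
  rainbowCount-pos {n} q A a<q = n≢0⇒n>0 λ eq → contradiction
    (trans (sym (*-zeroʳ (q ^ ∣ A ∣))) (trans (cong (q ^ ∣ A ∣ *_) (sym eq)) (rainbowCount-falling q A)))
    (<⇒≢ (*-mono-< (falling-pos ∣ A ∣ (<⇒≤ a<q)) (m^n>0 q {{>-nonZero (≤-trans (s≤s z≤n) a<q)}} n)))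
    where
    falling-pos : ∀ k → k ≤ q → 0 < falling q 0 k
    falling-pos zero    _   = s≤s z≤n
    falling-pos (suc k) k<q = *-mono-< (m<n⇒0<n∸m k<q) (falling-pos k (<⇒≤ k<q))

  -- Every factor q - i with i < t ≤ r is at least q - r, hence at least q / L.
  ^≤^*falling : ∀ {q L r} t → t ≤ r → q ≤ L * (q ∸ r) → q ^ t ≤ L ^ t * falling q 0 t
  ^≤^*falling         zero    _   _ = s≤s z≤n
  ^≤^*falling {q} {L} {r} (suc t) t<r h = begin
    q * q ^ t                                      ≤⟨ *-mono-≤ (≤-trans h (*-monoʳ-≤ L (∸-monoʳ-≤ q (<⇒≤ t<r))))
                                                               (^≤^*falling t (<⇒≤ t<r) h) ⟩
    L * (q ∸ t) * (L ^ t * falling q 0 t)          ≡⟨ lemma L (q ∸ t) (L ^ t) (falling q 0 t) ⟩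
    L ^ suc t * falling q 0 (suc t)                ∎
    where
    open ≤-Reasoning
    lemma : ∀ a b c d → a * b * (c * d) ≡ a * c * (b * d)
    lemma = solve-∀

  -- Extending a rainbow colouring from B ∩ A to B has probability `ff` / q^k, and the same factor
  -- appears when A is required to be rainbow as well. Exchanging one for the other gives P(A and B)
  -- ≤ P(A) P(B) / P(B ∩ A), and the denominator is at least L^(-t).
  rainbowCount₂-bound : ∀ {L} (q : ℕ) .{{_ : NonZero q}} (A B : Subset n) → q ≤ L * (q ∸ ∣ B ∣) →
    rainbowCount₂ q A B * q ^ n ≤ L ^ ∣ B ∩ A ∣ * (rainbowCount q A * rainbowCount q B)
  rainbowCount₂-bound {n} {L} q A B h = *-cancelˡ-≤ (q ^ k) {{m^n≢0 q k}} (begin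
    q ^ k * (rainbowCount₂ q A B * q ^ n)      ≡⟨ sym (*-assoc (q ^ k) _ _) ⟩
    q ^ k * rainbowCount₂ q A B * q ^ n        ≤⟨ *-mono-≤ pairs colorings ⟩
    ff * rainbowCount q A * (L ^ t * Y)        ≡⟨ l₁ ff _ (L ^ t) Y ⟩
    L ^ t * rainbowCount q A * (ff * Y)        ≡⟨ cong (L ^ t * rainbowCount q A *_) (sym single) ⟩
    L ^ t * rainbowCount q A * (q ^ k * rainbowCount q B) ≡⟨ l₂ (L ^ t) _ (q ^ k) _ ⟩
    q ^ k * (L ^ t * (rainbowCount q A * rainbowCount q B))
      ≡⟨ cong (λ e → q ^ k * (L ^ e * (rainbowCount q A * rainbowCount q B))) (length-elements (B ∩ A)) ⟩
    q ^ k * (L ^ ∣ B ∩ A ∣ * (rainbowCount q A * rainbowCount q B)) ∎)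
    where
    open ≤-Reasoning
    l₁ : ∀ a b c d → a * b * (c * d) ≡ c * b * (a * d)
    l₁ = solve-∀
    l₂ : ∀ a b c d → a * b * (c * d) ≡ c * (a * (b * d))
    l₂ = solve-∀
    l₃ : ∀ a b c → a * b * c ≡ b * (a * c)
    l₃ = solve-∀
    k = length (only A B)
    t = length (both A B)
    ff = falling q t k
    Y = ∑ (allColorings n q) (λ c → ⟦ distinct (colors c (both A B)) ⟧)
    rb : ∀ c → isRainbowᵇ c B ≡ distinct (colors c (only A B ++ both A B))
    rb = isRainbowᵇ≡distinct B (only-both-unique A B) (only-both-enumerates A B)
    pairs : q ^ k * rainbowCount₂ q A B ≤ ff * rainbowCount q A
    pairs = begin
      q ^ k * rainbowCount₂ q A B
        ≡⟨ cong (q ^ k *_) (∑-cong (allColorings n q) (λ c → cong (λ b → ⟦ isRainbowᵇ c A ⟧ * ⟦ b ⟧) (rb c))) ⟩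
      q ^ k * ∑ (allColorings n q) (λ c → ⟦ isRainbowᵇ c A ⟧ * ⟦ distinct (colors c (only A B ++ both A B)) ⟧)
        ≡⟨ ∑-distinct-++ (λ c → ⟦ isRainbowᵇ c A ⟧) (only A B) (both A B) (only-both-unique A B)
             (λ x∈ → isRainbowᵇ-independent A (∈-only⇒∉ A B x∈)) ⟩
      ff * ∑ (allColorings n q) (λ c → ⟦ isRainbowᵇ c A ⟧ * ⟦ distinct (colors c (both A B)) ⟧)
        -- If `A` is rainbow then so is `B ∩ A`; bounding its indicator by 1 loses nothing.
        ≤⟨ *-monoʳ-≤ ff (∑-mono (allColorings n q) (λ c →
             ≤-trans (*-monoʳ-≤ ⟦ isRainbowᵇ c A ⟧ (⟦⟧≤1 (distinct (colors c (both A B))))) (≤-reflexive (*-identityʳ _)))) ⟩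
      ff * rainbowCount q A ∎
    single : q ^ k * rainbowCount q B ≡ ff * Y
    single = trans (cong (q ^ k *_) (trans (∑-cong (allColorings n q) (λ c → cong ⟦_⟧ (rb c)))
        (sym (∑-1*⟦⟧ (allColorings n q) _))))
      (trans (∑-distinct-++ (λ _ → 1) (only A B) (both A B) (only-both-unique A B) (λ _ _ _ → refl))
        (cong (ff *_) (∑-1*⟦⟧ (allColorings n q) _)))
    colorings : q ^ n ≤ L ^ t * Y
    colorings = *-cancelˡ-≤ (q ^ t) {{m^n≢0 q t}} (begin
      q ^ t * q ^ n                       ≤⟨ *-monoˡ-≤ (q ^ n) (^≤^*falling t t≤∣B∣ h) ⟩
      L ^ t * falling q 0 t * q ^ n       ≡⟨ *-assoc (L ^ t) _ _ ⟩
      L ^ t * (falling q 0 t * q ^ n)     ≡⟨ cong (L ^ t *_) (sym (∑-distinct (both A B) (elements-unique (B ∩ A)))) ⟩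
      L ^ t * (q ^ t * Y)                 ≡⟨ l₂′ (L ^ t) (q ^ t) Y ⟩
      q ^ t * (L ^ t * Y)                 ∎)
      where
      l₂′ : ∀ a b c → a * (b * c) ≡ b * (a * c)
      l₂′ = solve-∀
      t≤∣B∣ : t ≤ ∣ B ∣
      t≤∣B∣ = ≤-trans (≤-reflexive (length-elements (B ∩ A))) (∣p∩q∣≤∣p∣ B A)

  -- The second moment method

  2*m*n≤m²+n² : ∀ a b → 2 * (a * b) ≤ a * a + b * b
  2*m*n≤m²+n² a b with ≤-total a b
  ... | inj₁ a≤b with m≤n⇒∃[o]m+o≡n a≤b
  ...   | o , refl = ≤-trans (m≤m+n _ (o * o)) (≤-reflexive (lemma a o))
    where
    lemma : ∀ a o → 2 * (a * (a + o)) + o * o ≡ a * a + (a + o) * (a + o)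
    lemma = solve-∀
  2*m*n≤m²+n² a b | inj₂ b≤a with m≤n⇒∃[o]m+o≡n b≤a
  ...   | o , refl = ≤-trans (m≤m+n _ (o * o)) (≤-reflexive (lemma b o))
    where
    lemma : ∀ b o → 2 * ((b + o) * b) + o * o ≡ (b + o) * (b + o) + b * b
    lemma = solve-∀

  -- Sum (s [p] - N X)² ≥ 0 over the outcomes, where X = [p] X: this gives 2 N s² ≤ s² G + N² Q.
  -- Inserting the bound on N Q and cancelling s² > 0 yields G ≥ (1 - 1/e) N.
  second-moment : (xs : List A) (p : A → Bool) (X : A → ℕ) (e N : ℕ) →
    (∀ x → p x ≡ false → X x ≡ 0) → 0 < ∑ xs X →
    e * (N * ∑ xs (λ x → X x * X x)) ≤ suc e * (∑ xs X * ∑ xs X) →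
    e * N ≤ e * ∑ xs (λ x → ⟦ p x ⟧) + N
  second-moment xs p X e N X≡0 s>0 h = *-cancelʳ-≤ _ _ (s * s) {{m*n≢0 s s {{>-nonZero s>0}} {{>-nonZero s>0}}}}
      (+-cancelʳ-≤ (e * N * (s * s)) _ _ (begin
    e * N * (s * s) + e * N * (s * s)             ≡⟨ l₁ e N s ⟩
    e * (2 * (N * s * s))                         ≤⟨ *-monoʳ-≤ e summed ⟩
    e * (s * s * G + N * N * Q)                   ≡⟨ l₂ e (s * s) G N Q ⟩
    e * G * (s * s) + N * (e * (N * Q))           ≤⟨ +-monoʳ-≤ (e * G * (s * s)) (*-monoʳ-≤ N h) ⟩
    e * G * (s * s) + N * (suc e * (s * s))       ≡⟨ l₃ e G N (s * s) ⟩
    (e * G + N) * (s * s) + e * N * (s * s)       ∎))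
    where
    open ≤-Reasoning
    s = ∑ xs X
    G = ∑ xs (λ x → ⟦ p x ⟧)
    Q = ∑ xs (λ x → X x * X x)
    l₁ : ∀ e N s → e * N * (s * s) + e * N * (s * s) ≡ e * (2 * (N * s * s))
    l₁ = solve-∀
    l₂ : ∀ e s G N Q → e * (s * G + N * N * Q) ≡ e * G * s + N * (e * (N * Q))
    l₂ = solve-∀
    l₃ : ∀ e G N s → e * G * s + N * (suc e * s) ≡ (e * G + N) * s + e * N * s
    l₃ = solve-∀
    pointwise : ∀ x → 2 * (N * s) * X x ≤ s * s * ⟦ p x ⟧ + N * N * (X x * X x)
    pointwise x with p x in px
    ... | false rewrite X≡0 x px | *-zeroʳ (2 * (N * s)) = z≤n
    ... | true = ≤-trans (≤-reflexive (a₁ N s (X x)))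
                   (≤-trans (2*m*n≤m²+n² s (N * X x)) (≤-reflexive (a₂ N s (X x))))
      where
      a₁ : ∀ N s x → 2 * (N * s) * x ≡ 2 * (s * (N * x))
      a₁ = solve-∀
      a₂ : ∀ N s x → s * s + N * x * (N * x) ≡ s * s * 1 + N * N * (x * x)
      a₂ = solve-∀
    summed : 2 * (N * s * s) ≤ s * s * G + N * N * Q
    summed = begin
      2 * (N * s * s)                              ≡⟨ a₁ N s ⟩
      2 * (N * s) * s                              ≡⟨ sym (∑-*ˡ xs (2 * (N * s)) X) ⟩
      ∑ xs (λ x → 2 * (N * s) * X x)               ≤⟨ ∑-mono xs pointwise ⟩
      ∑ xs (λ x → s * s * ⟦ p x ⟧ + N * N * (X x * X x)) ≡⟨ ∑-+ xs _ _ ⟩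
      ∑ xs (λ x → s * s * ⟦ p x ⟧) + ∑ xs (λ x → N * N * (X x * X x))
        ≡⟨ cong₂ _+_ (∑-*ˡ xs (s * s) _) (∑-*ˡ xs (N * N) _) ⟩
      s * s * G + N * N * Q                        ∎
      where
      a₁ : ∀ N s → 2 * (N * s * s) ≡ 2 * (N * s) * s
      a₁ = solve-∀

  -- Linearity of expectation, with independence of the two coordinates. It serves the first moment
  -- with `ks` the edges, and the second with `ks` the pairs of edges.
  ∑-×-factor : (xs : List A) (ys : List B) (ks : List K) (u : A → K → ℕ) (v : B → K → ℕ) →
    ∑ (cartesianProduct xs ys) (λ p → ∑ ks (λ k → u (proj₁ p) k * v (proj₂ p) k)) ≡
    ∑ ks (λ k → ∑ xs (λ x → u x k) * ∑ ys (λ y → v y k))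
  ∑-×-factor xs ys ks u v = begin
    ∑ (cartesianProduct xs ys) (λ p → ∑ ks (λ k → u (proj₁ p) k * v (proj₂ p) k))
      ≡⟨ ∑-swap (cartesianProduct xs ys) ks _ ⟩
    ∑ ks (λ k → ∑ (cartesianProduct xs ys) (λ p → u (proj₁ p) k * v (proj₂ p) k))
      ≡⟨ ∑-cong ks (λ k → trans (∑-cartesianProduct xs ys)
           (trans (∑-cong xs (λ x → ∑-*ˡ ys (u x k) _)) (∑-*ʳ xs _ _))) ⟩
    ∑ ks (λ k → ∑ xs (λ x → u x k) * ∑ ys (λ y → v y k)) ∎
    where open ≡-Reasoning

  ∑-*-∑ : (xs : List A) (ys : List B) (g : A → ℕ) (h : B → ℕ) →
    ∑ xs g * ∑ ys h ≡ ∑ (cartesianProduct xs ys) (λ p → g (proj₁ p) * h (proj₂ p))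
  ∑-*-∑ xs ys g h = sym (trans (∑-cartesianProduct xs ys)
    (trans (∑-cong xs (λ x → ∑-*ˡ ys (g x) h)) (∑-*ʳ xs g _)))

  any-false⇒∑≡0 : (p : A → Bool) (xs : List A) → any p xs ≡ false → ∑ xs (λ x → ⟦ p x ⟧) ≡ 0
  any-false⇒∑≡0 p []       _  = refl
  any-false⇒∑≡0 p (x ∷ xs) eq with p x
  ... | false = any-false⇒∑≡0 p xs eq

  -- The series Σ (e+1)^(-t) over t < k, multiplied by e (e+1)^r. The extra summand is the remainder
  -- that makes the induction on `k` exact; it is dropped at k = r + 1.
  ∑-geometric : ∀ e r k → k ≤ suc r → e * ∑ (downFrom k) (λ t → suc e ^ (r ∸ t)) + suc e ^ (suc r ∸ k) ≡ suc e ^ suc r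
  ∑-geometric e r zero    _   rewrite *-zeroʳ e = refl
  ∑-geometric e r (suc k) k<r = begin
    e * (suc e ^ (r ∸ k) + S) + suc e ^ (r ∸ k)   ≡⟨ lemma e (suc e ^ (r ∸ k)) S ⟩
    e * S + suc e ^ suc (r ∸ k)                   ≡⟨ cong (λ x → e * S + suc e ^ x) (sym (+-∸-assoc 1 (s≤s⁻¹ k<r))) ⟩
    e * S + suc e ^ (suc r ∸ k)                   ≡⟨ ∑-geometric e r k (<⇒≤ k<r) ⟩
    suc e ^ suc r                                 ∎
    where
    open ≡-Reasoning
    S = ∑ (downFrom k) (λ t → suc e ^ (r ∸ t))
    lemma : ∀ e p S → e * (p + S) + p ≡ e * S + suc e * p
    lemma = solve-∀

  ∑-by-intersection : ∀ {r} (H : Hypergraph n) (A : Subset n) → (∀ B → B ∈ H → ∣ B ∩ A ∣ ≤ r) → (g : ℕ → ℕ) →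
    ∑ H (λ B → g ∣ B ∩ A ∣) ≤ ∑ (downFrom (suc r)) (λ t → f H t A * g t)
  ∑-by-intersection {r = r} H A ≤r g = begin
    ∑ H (λ B → g ∣ B ∩ A ∣)
      ≤⟨ ∑-mono-∈ H (λ B B∈H → ≤-trans (≤-reflexive (sym (diagonal ∣ B ∩ A ∣)))
           (∈⇒≤∑ (λ t → ⟦ ∣ B ∩ A ∣ ≡ᵇ t ⟧ * g t) (∈-downFrom⁺ (s≤s (≤r B B∈H))))) ⟩
    ∑ H (λ B → ∑ (downFrom (suc r)) (λ t → ⟦ ∣ B ∩ A ∣ ≡ᵇ t ⟧ * g t))
      ≡⟨ ∑-swap H (downFrom (suc r)) _ ⟩
    ∑ (downFrom (suc r)) (λ t → ∑ H (λ B → ⟦ ∣ B ∩ A ∣ ≡ᵇ t ⟧ * g t))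
      ≡⟨ ∑-cong (downFrom (suc r)) (λ t → trans (∑-*ʳ H _ (g t))
           (cong (_* g t) (sym (length-filterᵇ (λ B → ∣ B ∩ A ∣ ≡ᵇ t) H)))) ⟩
    ∑ (downFrom (suc r)) (λ t → f H t A * g t) ∎
    where
    open ≤-Reasoning
    diagonal : ∀ s → ⟦ s ≡ᵇ s ⟧ * g s ≡ g s
    diagonal s = trans (cong (λ b → ⟦ b ⟧ * g s) (dec-true (s ℕ.≟ s) refl)) (+-identityʳ (g s))

  ^-distribʳ-* : ∀ t a b → (a * b) ^ t ≡ a ^ t * b ^ t
  ^-distribʳ-* zero    a b = refl
  ^-distribʳ-* (suc t) a b rewrite ^-distribʳ-* t a b = lemma a b (a ^ t) (b ^ t)
    where
    lemma : ∀ a b x y → a * b * (x * y) ≡ a * x * (b * y)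
    lemma = solve-∀

  -- The rational data κ, K₀ and ε₁ are absorbed into natural numbers. By `f-bound`, the fraction of
  -- edges meeting A in t vertices is at most (m / (2nL(e+1)))^t; against the gain (2nL/m)^t of such
  -- a pair this leaves (e+1)^(-t).
  module _ (n m d r q l e : ℕ) (H : Hypergraph n)
    (uniform : IsUniform r H) (H≢[] : H ≢ [])
    (m+d≡n : m + d ≡ n) (2r≤m : r + r ≤ m) (0<m : 0 < m)
    (r<q : r < q) (q≤L[q-r] : q ≤ suc l * (q ∸ r))
    (f-bound : ∀ A → A ∈ H → ∀ t → 1 ≤ t → f H t A * ((n + n) * suc l * suc e) ^ t ≤ length H * m ^ t) where

    private
      L = suc l
      E = suc e
      M = length H
      N = q ^ n * (n C d)

      instance
        q≢0 : NonZero q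
        q≢0 = >-nonZero (≤-trans (s≤s z≤n) r<q)
        m≢0 : NonZero m
        m≢0 = >-nonZero 0<m

    f-bound₀ : ∀ A → A ∈ H → ∀ t → f H t A * ((n + n) * L * E) ^ t ≤ M * m ^ t
    f-bound₀ A A∈H zero    = *-monoˡ-≤ 1 (length-filter _ H)
    f-bound₀ A A∈H (suc t) = f-bound A A∈H (suc t) (s≤s z≤n)

    -- Binomials take d = n - m below: an m-subset containing A is a choice of d vertices outside A to omit.
    hitCount : Subset n → ℕ
    hitCount A = rainbowCount q A * (∣ ∁ A ∣ C d)

    hitCount₂ : Subset n → Subset n → ℕ
    hitCount₂ A B = rainbowCount₂ q A B * (∣ ∁ (A ∪ B) ∣ C d)

    hitCount₂-bound : ∀ A B → A ∈ H → B ∈ H →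
      N * hitCount₂ A B * m ^ ∣ B ∩ A ∣ ≤ ((n + n) * L) ^ ∣ B ∩ A ∣ * (hitCount A * hitCount A)
    hitCount₂-bound A B A∈H B∈H = begin
      q ^ n * (n C d) * (rainbowCount₂ q A B * u) * m ^ t     ≡⟨ l₁ (q ^ n) (n C d) (rainbowCount₂ q A B) u (m ^ t) ⟩
      rainbowCount₂ q A B * q ^ n * (u * (n C d) * m ^ t)
        ≤⟨ *-mono-≤ (rainbowCount₂-bound q A B (subst (λ s → q ≤ L * (q ∸ s)) (sym (uniform B B∈H)) q≤L[q-r]))
                    (∑-⊇-∪-bound m+d≡n 2r≤m A B (uniform A A∈H) (uniform B B∈H)) ⟩
      L ^ t * (rainbowCount q A * rainbowCount q B) * ((n + n) ^ t * (w * w))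
        ≡⟨ cong (λ c → L ^ t * (rainbowCount q A * c) * ((n + n) ^ t * (w * w)))
             (rainbowCount-≡ q {B} {A} (trans (uniform B B∈H) (sym (uniform A A∈H)))) ⟩
      L ^ t * (rainbowCount q A * rainbowCount q A) * ((n + n) ^ t * (w * w))
        ≡⟨ l₂ (L ^ t) (rainbowCount q A) ((n + n) ^ t) w ⟩
      (n + n) ^ t * L ^ t * (hitCount A * hitCount A)
        ≡⟨ cong (_* (hitCount A * hitCount A)) (sym (^-distribʳ-* t (n + n) L)) ⟩
      ((n + n) * L) ^ t * (hitCount A * hitCount A) ∎
      where
      open ≤-Reasoning
      t = ∣ B ∩ A ∣
      u = ∣ ∁ (A ∪ B) ∣ C d
      w = ∣ ∁ A ∣ C d
      l₁ : ∀ a b c u m → a * b * (c * u) * m ≡ c * a * (u * b * m)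
      l₁ = solve-∀
      l₂ : ∀ l c k w → l * (c * c) * (k * (w * w)) ≡ k * l * (c * w * (c * w))
      l₂ = solve-∀

    -- In fractions: the sum over B of (2nL/m)^|B ∩ A| is at most (1 + 1/e) |H|. The factor m^r
    -- (e+1)^r clears all powers because |B ∩ A| ≤ r.
    ∑-f-bound : ∀ A → A ∈ H →
      e * ∑ H (λ B → ((n + n) * L) ^ ∣ B ∩ A ∣ * m ^ (r ∸ ∣ B ∩ A ∣)) * E ^ r ≤ E * M * (m ^ r * E ^ r)
    ∑-f-bound A A∈H = begin
      e * ∑ H (λ B → z ^ ∣ B ∩ A ∣ * m ^ (r ∸ ∣ B ∩ A ∣)) * E ^ r
        ≤⟨ *-monoˡ-≤ (E ^ r) (*-monoʳ-≤ e (∑-by-intersection H A (λ B B∈H →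
             ≤-trans (∣p∩q∣≤∣p∣ B A) (≤-reflexive (uniform B B∈H))) (λ t → z ^ t * m ^ (r ∸ t)))) ⟩
      e * ∑ (downFrom (suc r)) (λ t → f H t A * (z ^ t * m ^ (r ∸ t))) * E ^ r
        ≡⟨ trans (*-assoc e _ _) (cong (e *_) (sym (∑-*ʳ (downFrom (suc r)) (λ t → f H t A * (z ^ t * m ^ (r ∸ t))) (E ^ r)))) ⟩
      e * ∑ (downFrom (suc r)) (λ t → f H t A * (z ^ t * m ^ (r ∸ t)) * E ^ r)
        ≤⟨ *-monoʳ-≤ e (∑-mono-∈ (downFrom (suc r)) (λ t t∈ → term t (s≤s⁻¹ (∈-downFrom⁻ t∈)))) ⟩
      e * ∑ (downFrom (suc r)) (λ t → M * m ^ r * E ^ (r ∸ t))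
        ≡⟨ cong (e *_) (∑-*ˡ (downFrom (suc r)) (M * m ^ r) _) ⟩
      e * (M * m ^ r * ∑ (downFrom (suc r)) (λ t → E ^ (r ∸ t)))
        ≡⟨ l₁ e (M * m ^ r) _ ⟩
      M * m ^ r * (e * ∑ (downFrom (suc r)) (λ t → E ^ (r ∸ t)))
        ≤⟨ *-monoʳ-≤ (M * m ^ r) (≤-trans (m≤m+n _ _) (≤-reflexive (∑-geometric e r (suc r) ≤-refl))) ⟩
      M * m ^ r * (E * E ^ r) ≡⟨ l₂ M (m ^ r) E (E ^ r) ⟩
      E * M * (m ^ r * E ^ r) ∎
      where
      open ≤-Reasoning
      z = (n + n) * L
      l₁ : ∀ a b c → a * (b * c) ≡ b * (a * c)
      l₁ = solve-∀
      l₂ : ∀ a b c d → a * b * (c * d) ≡ c * a * (b * d)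
      l₂ = solve-∀
      ^-split : ∀ x {t} → t ≤ r → x ^ r ≡ x ^ t * x ^ (r ∸ t)
      ^-split x {t} t≤r = trans (cong (x ^_) (sym (m+[n∸m]≡n t≤r))) (^-distribˡ-+-* x t (r ∸ t))
      term : ∀ t → t ≤ r → f H t A * (z ^ t * m ^ (r ∸ t)) * E ^ r ≤ M * m ^ r * E ^ (r ∸ t)
      term t t≤r = begin
        f H t A * (z ^ t * m ^ (r ∸ t)) * E ^ r
          ≡⟨ cong (f H t A * (z ^ t * m ^ (r ∸ t)) *_) (^-split E t≤r) ⟩
        f H t A * (z ^ t * m ^ (r ∸ t)) * (E ^ t * E ^ (r ∸ t))
          ≡⟨ a₁ (f H t A) (z ^ t) (m ^ (r ∸ t)) (E ^ t) (E ^ (r ∸ t)) ⟩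
        f H t A * (z ^ t * E ^ t) * (m ^ (r ∸ t) * E ^ (r ∸ t))
          ≡⟨ cong (λ x → f H t A * x * (m ^ (r ∸ t) * E ^ (r ∸ t))) (sym (^-distribʳ-* t z E)) ⟩
        f H t A * (z * E) ^ t * (m ^ (r ∸ t) * E ^ (r ∸ t))
          ≤⟨ *-monoˡ-≤ (m ^ (r ∸ t) * E ^ (r ∸ t)) (f-bound₀ A A∈H t) ⟩
        M * m ^ t * (m ^ (r ∸ t) * E ^ (r ∸ t))
          ≡⟨ a₂ M (m ^ t) (m ^ (r ∸ t)) (E ^ (r ∸ t)) ⟩
        M * (m ^ t * m ^ (r ∸ t)) * E ^ (r ∸ t)
          ≡⟨ cong (λ x → M * x * E ^ (r ∸ t)) (sym (^-split m t≤r)) ⟩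
        M * m ^ r * E ^ (r ∸ t) ∎
        where
        a₁ : ∀ f z m x y → f * (z * m) * (x * y) ≡ f * (z * x) * (m * y)
        a₁ = solve-∀
        a₂ : ∀ M a b c → M * a * (b * c) ≡ M * (a * b) * c
        a₂ = solve-∀

    -- The second moment with one edge fixed: the square of `hitCount A` factors out of the sum over
    -- B, and `∑-f-bound` remains.
    ∑-hitCount₂-bound : ∀ A → A ∈ H →
      e * (N * ∑ H (hitCount₂ A)) ≤ E * M * (hitCount A * hitCount A)
    ∑-hitCount₂-bound A A∈H = *-cancelʳ-≤ _ _ (m ^ r * E ^ r) {{m*n≢0 _ _ {{m^n≢0 m r}} {{m^n≢0 E r}}}} (begin
      e * (N * ∑ H (hitCount₂ A)) * (m ^ r * E ^ r)
        ≡⟨ l₁ e N (∑ H (hitCount₂ A)) (m ^ r) (E ^ r) ⟩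
      e * (N * m ^ r * ∑ H (hitCount₂ A)) * E ^ r
        ≡⟨ cong (λ x → e * x * E ^ r) (sym (∑-*ˡ H (N * m ^ r) (hitCount₂ A))) ⟩
      e * ∑ H (λ B → N * m ^ r * hitCount₂ A B) * E ^ r
        ≤⟨ *-monoˡ-≤ (E ^ r) (*-monoʳ-≤ e (∑-mono-∈ H term)) ⟩
      e * ∑ H (λ B → D² * (z ^ ∣ B ∩ A ∣ * m ^ (r ∸ ∣ B ∩ A ∣))) * E ^ r
        ≡⟨ cong (λ x → e * x * E ^ r) (∑-*ˡ H D² _) ⟩
      e * (D² * ∑ H (λ B → z ^ ∣ B ∩ A ∣ * m ^ (r ∸ ∣ B ∩ A ∣))) * E ^ r
        ≡⟨ l₂ e D² _ (E ^ r) ⟩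
      D² * (e * ∑ H (λ B → z ^ ∣ B ∩ A ∣ * m ^ (r ∸ ∣ B ∩ A ∣)) * E ^ r)
        ≤⟨ *-monoʳ-≤ D² (∑-f-bound A A∈H) ⟩
      D² * (E * M * (m ^ r * E ^ r))
        ≡⟨ l₃ D² (E * M) (m ^ r * E ^ r) ⟩
      E * M * D² * (m ^ r * E ^ r) ∎)
      where
      open ≤-Reasoning
      z = (n + n) * L
      D² = hitCount A * hitCount A
      l₁ : ∀ e N p m x → e * (N * p) * (m * x) ≡ e * (N * m * p) * x
      l₁ = solve-∀
      l₂ : ∀ e d s x → e * (d * s) * x ≡ d * (e * s * x)
      l₂ = solve-∀
      l₃ : ∀ a b c → a * (b * c) ≡ b * a * c
      l₃ = solve-∀
      term : ∀ B → B ∈ H → N * m ^ r * hitCount₂ A B ≤ D² * (z ^ ∣ B ∩ A ∣ * m ^ (r ∸ ∣ B ∩ A ∣))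
      term B B∈H = begin
        N * m ^ r * hitCount₂ A B
          ≡⟨ cong (λ x → N * x * hitCount₂ A B) (trans (cong (m ^_) (sym (m+[n∸m]≡n t≤r))) (^-distribˡ-+-* m t (r ∸ t))) ⟩
        N * (m ^ t * m ^ (r ∸ t)) * hitCount₂ A B     ≡⟨ a₁ N (m ^ t) (m ^ (r ∸ t)) (hitCount₂ A B) ⟩
        N * hitCount₂ A B * m ^ t * m ^ (r ∸ t)       ≤⟨ *-monoˡ-≤ (m ^ (r ∸ t)) (hitCount₂-bound A B A∈H B∈H) ⟩
        z ^ t * D² * m ^ (r ∸ t)                      ≡⟨ a₂ (z ^ t) D² (m ^ (r ∸ t)) ⟩
        D² * (z ^ t * m ^ (r ∸ t))                    ∎
        where
        t = ∣ B ∩ A ∣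
        t≤r : t ≤ r
        t≤r = ≤-trans (∣p∩q∣≤∣p∣ B A) (≤-reflexive (uniform B B∈H))
        a₁ : ∀ N a b p → N * (a * b) * p ≡ N * p * a * b
        a₁ = solve-∀
        a₂ : ∀ a b c → a * b * c ≡ b * (a * c)
        a₂ = solve-∀

    private
      Ω : List (Coloring n q × Subset n)
      Ω = cartesianProduct (allColorings n q) (mSubsets n m)

      good : Coloring n q × Subset n → Bool
      good (c , S) = containsRainbowEdgeᵇ H c S

      X : Coloring n q × Subset n → ℕ
      X (c , S) = ∑ H (λ A → ⟦ isRainbowᵇ c A ⟧ * ⟦ A ⊆ᵇ S ⟧)

    X≡0 : ∀ p → good p ≡ false → X p ≡ 0
    X≡0 (c , S) eq = trans
      (∑-cong H (λ A → trans (*-comm ⟦ isRainbowᵇ c A ⟧ _) (sym (⟦⟧-∧ (A ⊆ᵇ S) (isRainbowᵇ c A)))))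
      (any-false⇒∑≡0 _ H eq)

    ∑-X : ∑ Ω X ≡ ∑ H hitCount
    ∑-X = trans (∑-×-factor (allColorings n q) (mSubsets n m) H (λ c A → ⟦ isRainbowᵇ c A ⟧) (λ S A → ⟦ A ⊆ᵇ S ⟧))
      (∑-cong H (λ A → cong (rainbowCount q A *_) (∑-⊇ m+d≡n A)))

    ∑-X² : ∑ Ω (λ p → X p * X p) ≡ ∑ H (λ A → ∑ H (hitCount₂ A))
    ∑-X² = begin
      ∑ Ω (λ p → X p * X p)
        ≡⟨ ∑-cong Ω (λ p → trans (∑-*-∑ H H _ _) (∑-cong (cartesianProduct H H) (λ k → l₁ (⟦ isRainbowᵇ (proj₁ p) (proj₁ k) ⟧) _ _ _))) ⟩
      ∑ Ω (λ p → ∑ (cartesianProduct H H) (λ k → u (proj₁ p) k * v (proj₂ p) k))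
        ≡⟨ ∑-×-factor (allColorings n q) (mSubsets n m) (cartesianProduct H H) u v ⟩
      ∑ (cartesianProduct H H) (λ k → ∑ (allColorings n q) (λ c → u c k) * ∑ (mSubsets n m) (λ S → v S k))
        ≡⟨ ∑-cartesianProduct H H ⟩
      ∑ H (λ A → ∑ H (λ B → rainbowCount₂ q A B * ∑ (mSubsets n m) (λ S → v S (A , B))))
        ≡⟨ ∑-cong H (λ A → ∑-cong H (λ B → cong (rainbowCount₂ q A B *_)
             (trans (∑-cong (mSubsets n m) (λ S → trans (sym (⟦⟧-∧ (A ⊆ᵇ S) (B ⊆ᵇ S))) (cong ⟦_⟧ (sym (∪-⊆ᵇ A B S)))))
               (∑-⊇ m+d≡n (A ∪ B))))) ⟩
      ∑ H (λ A → ∑ H (hitCount₂ A)) ∎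
      where
      open ≡-Reasoning
      l₁ : ∀ a b c d → a * b * (c * d) ≡ a * c * (b * d)
      l₁ = solve-∀
      u : Coloring n q → Subset n × Subset n → ℕ
      u c (A , B) = ⟦ isRainbowᵇ c A ⟧ * ⟦ isRainbowᵇ c B ⟧
      v : Subset n → Subset n × Subset n → ℕ
      v S (A , B) = ⟦ A ⊆ᵇ S ⟧ * ⟦ B ⊆ᵇ S ⟧

    totalCount≡ : totalCount n q m ≡ N
    totalCount≡ = begin
      length Ω                                                        ≡⟨ length≡∑ Ω ⟩
      ∑ Ω (λ _ → 1)                                                   ≡⟨ ∑-cartesianProduct (allColorings n q) (mSubsets n m) ⟩
      ∑ (allColorings n q) (λ _ → ∑ (mSubsets n m) (λ _ → 1))         ≡⟨ ∑-const (allColorings n q) _ ⟩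
      length (allColorings n q) * ∑ (mSubsets n m) (λ _ → 1)
        -- Every m-subset contains `⊥`, so the count of supersets gives their number.
        ≡⟨ cong₂ _*_ (length-allColorings n q) (trans
             (∑-cong (mSubsets n m) (λ S → cong ⟦_⟧ (sym (⊥-⊆ᵇ S)))) (∑-⊇ m+d≡n ⊥)) ⟩
      q ^ n * (∣ ∁ (⊥ {n}) ∣ C d)
        ≡⟨ cong (λ k → q ^ n * (k C d)) (trans (cong (_+ ∣ ∁ (⊥ {n}) ∣) (sym (∣⊥∣≡0 n))) (∣p∣+∣∁p∣≡n ⊥)) ⟩
      N ∎
      where
      open ≡-Reasoning

    -- Both factors depend only on the size of the edge. With the common value D, Σ X is `M * D`,
    -- and the bounds for single edges add up to a multiple of its square.
    hitCount-≡ : ∀ A B → A ∈ H → B ∈ H → hitCount A ≡ hitCount B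
    hitCount-≡ A B A∈H B∈H = cong₂ _*_ (rainbowCount-≡ q {A} {B} ∣A∣≡∣B∣)
      (cong (_C d) (+-cancelˡ-≡ ∣ A ∣ _ _ (trans (∣p∣+∣∁p∣≡n A)
        (trans (sym (∣p∣+∣∁p∣≡n B)) (cong (_+ ∣ ∁ B ∣) (sym ∣A∣≡∣B∣))))))
      where
      ∣A∣≡∣B∣ : ∣ A ∣ ≡ ∣ B ∣
      ∣A∣≡∣B∣ = trans (uniform A A∈H) (sym (uniform B B∈H))

    hitCount-pos : ∀ A → A ∈ H → 0 < hitCount A
    hitCount-pos A A∈H = *-mono-< (rainbowCount-pos q A (subst (_< q) (sym (uniform A A∈H)) r<q))
      (C-pos (+-cancelˡ-≤ r d ∣ ∁ A ∣ (begin
        r + d          ≤⟨ +-monoˡ-≤ d (≤-trans (m≤m+n r r) 2r≤m) ⟩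
        m + d          ≡⟨ trans m+d≡n (sym (∣p∣+∣∁p∣≡n A)) ⟩
        ∣ A ∣ + ∣ ∁ A ∣ ≡⟨ cong (_+ ∣ ∁ A ∣) (uniform A A∈H) ⟩
        r + ∣ ∁ A ∣     ∎)))
      where open ≤-Reasoning

    goodCount-bound : e * totalCount n q m ≤ e * goodCount H q m + totalCount n q m
    goodCount-bound rewrite totalCount≡ | length-filterᵇ good Ω = bound H refl
      where
      open ≤-Reasoning
      -- Matching on a copy exposes an edge `A₀` while the lemmas above keep speaking of `H`.
      bound : ∀ H′ → H′ ≡ H → e * N ≤ e * ∑ Ω (λ p → ⟦ good p ⟧) + N
      bound []       []≡H = contradiction (sym []≡H) H≢[]
      bound (A₀ ∷ _) H′≡H = second-moment Ω good X e N X≡0 ∑X>0 (begin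
        e * (N * ∑ Ω (λ p → X p * X p))                    ≡⟨ cong (λ x → e * (N * x)) ∑-X² ⟩
        e * (N * ∑ H (λ A → ∑ H (hitCount₂ A)))
          ≡⟨ trans (cong (e *_) (sym (∑-*ˡ H N _))) (sym (∑-*ˡ H e _)) ⟩
        ∑ H (λ A → e * (N * ∑ H (hitCount₂ A)))
          ≤⟨ ∑-mono-∈ H (λ A A∈H → ≤-trans (∑-hitCount₂-bound A A∈H)
               (≤-reflexive (cong (λ x → E * M * (x * x)) (hitCount-≡ A A₀ A∈H A₀∈H)))) ⟩
        ∑ H (λ _ → E * M * (D * D))                        ≡⟨ ∑-const H _ ⟩
        M * (E * M * (D * D))                              ≡⟨ l₁ M E D ⟩
        E * (M * D * (M * D))                              ≡⟨ cong (λ x → E * (x * x)) (sym ∑X≡) ⟩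
        E * (∑ Ω X * ∑ Ω X)                                ∎)
        where
        D = hitCount A₀
        A₀∈H : A₀ ∈ H
        A₀∈H = subst (A₀ ∈_) H′≡H (here refl)
        l₁ : ∀ M E D → M * (E * M * (D * D)) ≡ E * (M * D * (M * D))
        l₁ = solve-∀
        ∑X≡ : ∑ Ω X ≡ M * D
        ∑X≡ = trans ∑-X (trans (∑-cong-∈ H (λ A A∈H → hitCount-≡ A A₀ A∈H A₀∈H)) (∑-const H D))
        ∑X>0 : 0 < ∑ Ω X
        ∑X>0 = subst (0 <_) (sym ∑-X) (<-≤-trans (hitCount-pos A₀ A₀∈H) (∈⇒≤∑ hitCount A₀∈H))

  -- Spread hypergraphs

  ∈⇒1≤∑ : ∀ {A : Set} {x : A} {xs : List A} {p : A → Bool} → x ∈ xs → T (p x) → 1 ≤ ∑ xs (λ y → ⟦ p y ⟧)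
  ∈⇒1≤∑ {x = x} {p = p} x∈xs px with p x | ∈⇒≤∑ (λ y → ⟦ p y ⟧) x∈xs
  ... | true | h = h

  ∈-allSubsets : (S : Subset n) → S ∈ allSubsets n
  ∈-allSubsets []          = here refl
  ∈-allSubsets {suc n} (true  ∷ S) = ∈-concatMap⁺ (λ x → map (x ∷_) (allSubsets n)) {xs = true ∷ false ∷ []}
    (here (∈-map⁺ (true ∷_) (∈-allSubsets S)))
  ∈-allSubsets {suc n} (false ∷ S) = ∈-concatMap⁺ (λ x → map (x ∷_) (allSubsets n)) {xs = true ∷ false ∷ []}
    (there (here (∈-map⁺ (false ∷_) (∈-allSubsets S))))

  ∑-⊆ : (A : Subset n) → ∑ (allSubsets n) (λ S → ⟦ S ⊆ᵇ A ⟧) ≡ 2 ^ ∣ A ∣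
  ∑-⊆ [] = refl
  ∑-⊆ {suc n} (a ∷ A) = begin
    ∑ (allSubsets (suc n)) (λ S → ⟦ S ⊆ᵇ (a ∷ A) ⟧)
      ≡⟨ ∑-allVecs-suc (true ∷ false ∷ []) n _ ⟩
    ∑ (allSubsets n) (λ S → ⟦ (true ∷ S) ⊆ᵇ (a ∷ A) ⟧) + (∑ (allSubsets n) (λ S → ⟦ (false ∷ S) ⊆ᵇ (a ∷ A) ⟧) + 0)
      ≡⟨ cong₂ (λ x y → x + (y + 0))
           (∑-cong (allSubsets n) (λ S → cong ⟦_⟧ (⊆ᵇ-∷ true a S A)))
           (trans (∑-cong (allSubsets n) (λ S → cong ⟦_⟧ (⊆ᵇ-∷ false a S A))) (∑-⊆ A)) ⟩
    ∑ (allSubsets n) (λ S → ⟦ a ∧ (S ⊆ᵇ A) ⟧) + (2 ^ ∣ A ∣ + 0)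
      ≡⟨ lemma a ⟩
    2 ^ ∣ a ∷ A ∣ ∎
    where
    open ≡-Reasoning
    lemma : ∀ a → ∑ (allSubsets n) (λ S → ⟦ a ∧ (S ⊆ᵇ A) ⟧) + (2 ^ ∣ A ∣ + 0) ≡ 2 ^ ∣ a ∷ A ∣
    lemma true  = cong (_+ (2 ^ ∣ A ∣ + 0)) (∑-⊆ A)
    lemma false = trans (cong (_+ (2 ^ ∣ A ∣ + 0)) (∑-0 (allSubsets n))) (+-identityʳ _)

  ∩-⊆ᵇˡ : (B A : Subset n) → ((B ∩ A) ⊆ᵇ B) ≡ true
  ∩-⊆ᵇˡ []          []      = refl
  ∩-⊆ᵇˡ (true  ∷ B) (a ∷ A) = trans (⊆ᵇ-∷ a true (B ∩ A) B) (trans (cong (_∧ ((B ∩ A) ⊆ᵇ B)) (∨-true (not a))) (∩-⊆ᵇˡ B A))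
    where
    ∨-true : ∀ b → b ∨ true ≡ true
    ∨-true true  = refl
    ∨-true false = refl
  ∩-⊆ᵇˡ (false ∷ B) (a ∷ A) = trans (⊆ᵇ-∷ false false (B ∩ A) B) (∩-⊆ᵇˡ B A)

  ∩-⊆ᵇʳ : (B A : Subset n) → ((B ∩ A) ⊆ᵇ A) ≡ true
  ∩-⊆ᵇʳ B A = trans (cong (_⊆ᵇ A) (∩-comm B A)) (∩-⊆ᵇˡ A B)

  tSubsetsOf : (t : ℕ) → Subset n → List (Subset n)
  tSubsetsOf {n} t A = filterᵇ (_⊆ᵇ A) (mSubsets n t)

  ∈-tSubsetsOf : ∀ {t} {A S : Subset n} → S ∈ tSubsetsOf t A → ∣ S ∣ ≡ t
  ∈-tSubsetsOf {n} {t} {A} {S} S∈ = ≡ᵇ⇒≡ ∣ S ∣ t (proj₂ (∈-filter⁻ (λ S → T? (∣ S ∣ ≡ᵇ t)) {xs = allSubsets n}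
    (proj₁ (∈-filter⁻ (λ S → T? (S ⊆ᵇ A)) {xs = mSubsets n t} S∈))))

  -- A crude bound on a binomial coefficient. It serves t ≥ αr, where 2^r is itself at most a
  -- constant to the power t.
  length-tSubsetsOf : (t : ℕ) (A : Subset n) → length (tSubsetsOf t A) ≤ 2 ^ ∣ A ∣
  length-tSubsetsOf {n} t A = begin
    length (tSubsetsOf t A)                                          ≡⟨ length-filterᵇ (_⊆ᵇ A) (mSubsets n t) ⟩
    ∑ (mSubsets n t) (λ S → ⟦ S ⊆ᵇ A ⟧)                              ≡⟨ ∑-filterᵇ (λ S → ∣ S ∣ ≡ᵇ t) (allSubsets n) _ ⟩
    ∑ (allSubsets n) (λ S → ⟦ ∣ S ∣ ≡ᵇ t ⟧ * ⟦ S ⊆ᵇ A ⟧)             ≤⟨ ∑-mono (allSubsets n) (λ S →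
        ≤-trans (*-monoˡ-≤ ⟦ S ⊆ᵇ A ⟧ (⟦⟧≤1 (∣ S ∣ ≡ᵇ t))) (≤-reflexive (+-identityʳ _))) ⟩
    ∑ (allSubsets n) (λ S → ⟦ S ⊆ᵇ A ⟧)                              ≡⟨ ∑-⊆ A ⟩
    2 ^ ∣ A ∣                                                        ∎
    where open ≤-Reasoning

  -- A union bound over traces: for an edge `B` counted on the left, `B ∩ A` is a t-subset of `A`
  -- contained in `B`. Spreadness then applies to one trace at a time.
  f≤∑-countSuper : (H : Hypergraph n) (t : ℕ) (A : Subset n) → f H t A ≤ ∑ (tSubsetsOf t A) (countSuper H)
  f≤∑-countSuper {n} H t A = begin
    f H t A                                                  ≡⟨ length-filterᵇ (λ B → ∣ B ∩ A ∣ ≡ᵇ t) H ⟩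
    ∑ H (λ B → ⟦ ∣ B ∩ A ∣ ≡ᵇ t ⟧)                           ≤⟨ ∑-mono H trace ⟩
    ∑ H (λ B → ∑ (tSubsetsOf t A) (λ S → ⟦ S ⊆ᵇ B ⟧))        ≡⟨ ∑-swap H (tSubsetsOf t A) _ ⟩
    ∑ (tSubsetsOf t A) (λ S → ∑ H (λ B → ⟦ S ⊆ᵇ B ⟧))
      ≡⟨ ∑-cong (tSubsetsOf t A) (λ S → sym (length-filterᵇ (S ⊆ᵇ_) H)) ⟩
    ∑ (tSubsetsOf t A) (countSuper H)                        ∎
    where
    open ≤-Reasoning
    trace : ∀ B → ⟦ ∣ B ∩ A ∣ ≡ᵇ t ⟧ ≤ ∑ (tSubsetsOf t A) (λ S → ⟦ S ⊆ᵇ B ⟧)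
    trace B with ∣ B ∩ A ∣ ≡ᵇ t in eq
    ... | false = z≤n
    ... | true  = ∈⇒1≤∑ {p = _⊆ᵇ B}
      (∈-filter⁺ (λ S → T? (S ⊆ᵇ A)) {xs = mSubsets n t}
        (∈-filter⁺ (λ S → T? (∣ S ∣ ≡ᵇ t)) (∈-allSubsets (B ∩ A)) (subst T (sym eq) _))
        (subst T (sym (∩-⊆ᵇʳ B A)) _))
      (subst T (sym (∩-⊆ᵇˡ B A)) _)

  ⁅⁆-⊆ᵇ : (x : Fin n) (S : Subset n) → (⁅ x ⁆ ⊆ᵇ S) ≡ lookup S x
  ⁅⁆-⊆ᵇ zero    (true  ∷ S) = trans (⊆ᵇ-∷ true true ⊥ S) (⊥-⊆ᵇ S)
  ⁅⁆-⊆ᵇ zero    (false ∷ S) = ⊆ᵇ-∷ true false ⊥ S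
  ⁅⁆-⊆ᵇ (suc x) (b ∷ S)     = trans (⊆ᵇ-∷ false b ⁅ x ⁆ S) (⁅⁆-⊆ᵇ x S)

  -- Double counting of incidences between vertices and edges.
  ∑-degree : ∀ {r} (H : Hypergraph n) → IsUniform r H → ∑ (allFin n) (λ x → countSuper H ⁅ x ⁆) ≡ length H * r
  ∑-degree {n} {r} H uniform = begin
    ∑ (allFin n) (λ x → countSuper H ⁅ x ⁆)
      ≡⟨ ∑-cong (allFin n) (λ x → trans (length-filterᵇ (⁅ x ⁆ ⊆ᵇ_) H) (∑-cong H (λ A → cong ⟦_⟧ (⁅⁆-⊆ᵇ x A)))) ⟩
    ∑ (allFin n) (λ x → ∑ H (λ A → ⟦ lookup A x ⟧))   ≡⟨ ∑-swap (allFin n) H _ ⟩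
    ∑ H (λ A → ∑ (allFin n) (λ x → ⟦ lookup A x ⟧))   ≡⟨ ∑-cong-∈ H (λ A A∈H → trans (∑-lookup A) (uniform A A∈H)) ⟩
    ∑ H (λ _ → r)                                     ≡⟨ ∑-const H r ⟩
    length H * r                                      ∎
    where open ≡-Reasoning

-- From rational hypotheses to natural numbers

open import Defs
open import Data.Nat using (ℕ; zero; suc) renaming (_≤_ to _≤ℕ_)
import Data.Nat as ℕ
open import Data.Nat.Coprimality using (1-coprimeTo) renaming (sym to coprime-sym)
open import Data.Integer as ℤ using (+_)
import Data.Integer.Properties as ℤ
open import Data.Rational
open import Data.Rational.Properties
open import Data.Rational.Solver using (module +-*-Solver)
open +-*-Solver using (solve; _:=_; _:+_; _:*_; _:-_; con)

-- `toℚ n` is normalised through a gcd that does not compute for a variable `n`; in record form,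
-- order and arithmetic reduce to those of the integers.
toℚ≡mkℚ : ∀ n → toℚ n ≡ mkℚ (+ n) 0 (coprime-sym (1-coprimeTo n))
toℚ≡mkℚ n = normalize-coprime (coprime-sym (1-coprimeTo n))

toℚ-+ : ∀ m n → toℚ (m ℕ.+ n) ≡ toℚ m + toℚ n
toℚ-+ m n = sym (trans (cong₂ _+_ (toℚ≡mkℚ m) (toℚ≡mkℚ n))
  (cong (_/ 1) (cong₂ ℤ._+_ (ℤ.*-identityʳ (+ m)) (ℤ.*-identityʳ (+ n)))))

toℚ-* : ∀ m n → toℚ (m ℕ.* n) ≡ toℚ m * toℚ n
toℚ-* m n = sym (trans (cong₂ _*_ (toℚ≡mkℚ m) (toℚ≡mkℚ n)) (cong (_/ 1) (sym (ℤ.pos-* m n))))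

toℚ-^ : ∀ m t → toℚ (m ℕ.^ t) ≡ toℚ m ^ t
toℚ-^ m zero    = refl
toℚ-^ m (suc t) = trans (toℚ-* m (m ℕ.^ t)) (cong (toℚ m *_) (toℚ-^ m t))

toℚ-mono-≤ : ∀ {m n} → m ℕ.≤ n → toℚ m ≤ toℚ n
toℚ-mono-≤ {m} {n} m≤n = subst₂ _≤_ (sym (toℚ≡mkℚ m)) (sym (toℚ≡mkℚ n))
  (*≤* (ℤ.*-monoʳ-≤-nonNeg (+ 1) (ℤ.+≤+ m≤n)))

toℚ-cancel-≤ : ∀ {m n} → toℚ m ≤ toℚ n → m ℕ.≤ n
toℚ-cancel-≤ {m} {n} h with subst₂ _≤_ (toℚ≡mkℚ m) (toℚ≡mkℚ n) h
... | *≤* h′ = ℤ.drop‿+≤+ (ℤ.*-cancelʳ-≤-pos (+ m) (+ n) (+ 1) h′)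

0≤toℚ : ∀ n → 0ℚ ≤ toℚ n
0≤toℚ n = toℚ-mono-≤ {0} {n} ℕ.z≤n

toℚ-nonNeg : ∀ n → NonNegative (toℚ n)
toℚ-nonNeg n = nonNegative (0≤toℚ n)

toℚ-pos : ∀ {n} → 0 ℕ.< n → Positive (toℚ n)
toℚ-pos {n} 0<n = positive (<-≤-trans (*<* (ℤ.+<+ (ℕ.s≤s ℕ.z≤n))) (toℚ-mono-≤ {1} {n} 0<n))

upperℕ : (x : ℚ) → Σ ℕ λ k → x ≤ toℚ k
-- The denominator is at least 1, so the numerator is an upper bound.
upperℕ (mkℚ (+ p) d c) = p , subst (mkℚ (+ p) d c ≤_) (sym (toℚ≡mkℚ p))
  (*≤* (ℤ.*-monoˡ-≤-nonNeg (+ p) (ℤ.+≤+ (ℕ.s≤s ℕ.z≤n))))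
upperℕ x@(mkℚ ℤ.-[1+ p ] d c) = 0 , <⇒≤ (negative⁻¹ x)

archimedean : (x : ℚ) → 0ℚ < x → Σ ℕ λ k → 1ℚ ≤ toℚ k * x
archimedean x 0<x = proj₁ (upperℕ (1/ x)) , subst (_≤ toℚ (proj₁ (upperℕ (1/ x))) * x) (*-inverseˡ x)
  (*-monoʳ-≤-nonNeg x (proj₂ (upperℕ (1/ x))))
  where
  instance
    x>0 : Positive x
    x>0 = positive 0<x
    x≢0 : NonZero x
    x≢0 = pos⇒nonZero x
    x≥0 : NonNegative x
    x≥0 = pos⇒nonNeg x

*-mono-≤-nonNeg : ∀ {a b c d} → 0ℚ ≤ a → a ≤ b → 0ℚ ≤ c → c ≤ d → a * c ≤ b * d
*-mono-≤-nonNeg {a} {b} {c} {d} 0≤a a≤b 0≤c c≤d = ≤-trans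
  (*-monoʳ-≤-nonNeg c {{nonNegative 0≤c}} a≤b)
  (*-monoˡ-≤-nonNeg b {{nonNegative (≤-trans 0≤a a≤b)}} c≤d)

0≤^ : ∀ {x} → 0ℚ ≤ x → ∀ t → 0ℚ ≤ x ^ t
0≤^ 0≤x zero    = nonNegative⁻¹ 1ℚ
0≤^ {x} 0≤x (suc t) = subst (_≤ x * x ^ t) (*-zeroˡ 0ℚ) (*-mono-≤-nonNeg ≤-refl 0≤x ≤-refl (0≤^ 0≤x t))

^-mono-≤ : ∀ {x y} → 0ℚ ≤ x → x ≤ y → ∀ t → x ^ t ≤ y ^ t
^-mono-≤ 0≤x x≤y zero    = ≤-refl
^-mono-≤ 0≤x x≤y (suc t) = *-mono-≤-nonNeg 0≤x x≤y (0≤^ 0≤x t) (^-mono-≤ 0≤x x≤y t)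

^-*-distrib : ∀ t x y → (x * y) ^ t ≡ x ^ t * y ^ t
^-*-distrib zero    x y = refl
^-*-distrib (suc t) x y = trans (cong (x * y *_) (^-*-distrib t x y))
  (solve 4 (λ a b c d → a :* b :* (c :* d) := a :* c :* (b :* d)) refl x y (x ^ t) (y ^ t))

∑-scaled : ∀ {A : Set} (xs : List A) (g : A → ℕ) (k : ℚ) (M : ℕ) →
  (∀ x → x ∈ xs → toℚ (g x) * k ≤ toℚ M) → toℚ (∑ xs g) * k ≤ toℚ (length xs ℕ.* M)
∑-scaled []       g k M h = ≤-reflexive (*-zeroˡ k)
∑-scaled (x ∷ xs) g k M h = begin
  toℚ (g x ℕ.+ ∑ xs g) * k             ≡⟨ cong (_* k) (toℚ-+ (g x) (∑ xs g)) ⟩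
  (toℚ (g x) + toℚ (∑ xs g)) * k       ≡⟨ *-distribʳ-+ k (toℚ (g x)) (toℚ (∑ xs g)) ⟩
  toℚ (g x) * k + toℚ (∑ xs g) * k     ≤⟨ +-mono-≤ (h x (here refl)) (∑-scaled xs g k M (λ y y∈ → h y (there y∈))) ⟩
  toℚ M + toℚ (length xs ℕ.* M)        ≡⟨ sym (toℚ-+ M (length xs ℕ.* M)) ⟩
  toℚ (M ℕ.+ length xs ℕ.* M)          ∎
  where open ≤-Reasoning

αr≤t⇒r≤at : ∀ {α a r t} → 1ℚ ≤ toℚ a * α → α * toℚ r ≤ toℚ t → r ℕ.≤ a ℕ.* t
αr≤t⇒r≤at {α} {a} {r} {t} 1≤aα αr≤t = toℚ-cancel-≤ (begin
  toℚ r                       ≡⟨ sym (*-identityˡ (toℚ r)) ⟩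
  1ℚ * toℚ r                  ≤⟨ *-monoʳ-≤-nonNeg (toℚ r) {{toℚ-nonNeg r}} 1≤aα ⟩
  toℚ a * α * toℚ r           ≡⟨ *-assoc (toℚ a) α (toℚ r) ⟩
  toℚ a * (α * toℚ r)         ≤⟨ *-monoˡ-≤-nonNeg (toℚ a) {{toℚ-nonNeg a}} αr≤t ⟩
  toℚ a * toℚ t               ≡⟨ sym (toℚ-* a t) ⟩
  toℚ (a ℕ.* t)               ∎)
  where open ≤-Reasoning

-- From 1/l ≤ ε₁ follows q ≥ (1 + 1/l) r, that is q - r ≥ q / (l + 1). This is the origin of L = l +
-- 1.
palette-bound : ∀ {ε₁ l r q} → 1ℚ ≤ toℚ l * ε₁ → (1ℚ + ε₁) * toℚ r ≤ toℚ q → suc l ℕ.* r ℕ.≤ l ℕ.* q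
palette-bound {ε₁} {l} {r} {q} 1≤lε₁ h = toℚ-cancel-≤ (begin
  toℚ (suc l ℕ.* r)               ≡⟨ trans (toℚ-* (suc l) r) (cong (_* toℚ r) (toℚ-+ 1 l)) ⟩
  (1ℚ + toℚ l) * toℚ r            ≤⟨ *-monoʳ-≤-nonNeg (toℚ r) {{toℚ-nonNeg r}} (+-monoˡ-≤ (toℚ l) 1≤lε₁) ⟩
  (toℚ l * ε₁ + toℚ l) * toℚ r
    ≡⟨ solve 3 (λ l e r → (l :* e :+ l) :* r := l :* ((con 1ℚ :+ e) :* r)) refl (toℚ l) ε₁ (toℚ r) ⟩
  toℚ l * ((1ℚ + ε₁) * toℚ r)     ≤⟨ *-monoˡ-≤-nonNeg (toℚ l) {{toℚ-nonNeg l}} h ⟩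
  toℚ l * toℚ q                   ≡⟨ sym (toℚ-* l q) ⟩
  toℚ (l ℕ.* q)                   ∎)
  where open ≤-Reasoning

[1+l]r≤lq⇒q≤[1+l][q∸r] : ∀ l r q → suc l ℕ.* r ℕ.≤ l ℕ.* q → q ℕ.≤ suc l ℕ.* (q ℕ.∸ r)
[1+l]r≤lq⇒q≤[1+l][q∸r] l r q h = begin
  q                                   ≡⟨ sym (ℕ.m+n∸n≡m q (l ℕ.* q)) ⟩
  suc l ℕ.* q ℕ.∸ l ℕ.* q             ≤⟨ ℕ.∸-monoʳ-≤ (suc l ℕ.* q) h ⟩
  suc l ℕ.* q ℕ.∸ suc l ℕ.* r         ≡⟨ sym (ℕ.*-distribˡ-∸ (suc l) q r) ⟩
  suc l ℕ.* (q ℕ.∸ r)                 ∎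
  where open ℕ.≤-Reasoning

[1+l]r≤lq⇒r<q : ∀ l r q → 0 ℕ.< r → suc l ℕ.* r ℕ.≤ l ℕ.* q → r ℕ.< q
[1+l]r≤lq⇒r<q l r q 0<r h = ℕ.≰⇒> λ q≤r → ℕ.<-irrefl refl (ℕ.<-≤-trans (ℕ.m<n+m (l ℕ.* r) 0<r)
  (ℕ.≤-trans h (ℕ.*-monoʳ-≤ l q≤r)))

length-pos : ∀ {A : Set} {xs : List A} → xs ≢ [] → 0 ℕ.< length xs
length-pos {xs = []}    xs≢[] = contradiction refl xs≢[]
length-pos {xs = _ ∷ _} _     = ℕ.s≤s ℕ.z≤n

-- Consequences of spreadness for n, m and the intersection numbers

module _ {n : ℕ} {κ : ℚ} {H : Hypergraph n} {r : ℕ} (1≤κ : 1ℚ ≤ κ) (H≢[] : H ≢ [])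
  (spread : IsSpread κ H) (uniform : IsUniform r H) where

  private
    M = length H
    0≤κ : 0ℚ ≤ κ
    0≤κ = ≤-trans (nonNegative⁻¹ 1ℚ) 1≤κ

  -- The degrees of the n vertices add up to |H| r, and spreadness at singletons bounds each of them
  -- by |H| / κ.
  rκ≤n : toℚ r * κ ≤ toℚ n
  rκ≤n = *-cancelˡ-≤-pos (toℚ M) {{toℚ-pos (length-pos H≢[])}} (begin
    toℚ M * (toℚ r * κ)         ≡⟨ sym (*-assoc (toℚ M) (toℚ r) κ) ⟩
    toℚ M * toℚ r * κ           ≡⟨ cong (_* κ) (sym (toℚ-* M r)) ⟩
    toℚ (M ℕ.* r) * κ           ≡⟨ cong (λ s → toℚ s * κ) (sym (∑-degree H uniform)) ⟩
    toℚ (∑ (allFin n) (λ x → countSuper H ⁅ x ⁆)) * κ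
      ≤⟨ ∑-scaled (allFin n) _ κ M (λ x _ → subst (λ k → toℚ (countSuper H ⁅ x ⁆) * k ≤ toℚ M)
           (trans (cong (κ ^_) (∣⁅x⁆∣≡1 x)) (*-identityʳ κ)) (spread ⁅ x ⁆)) ⟩
    toℚ (length (allFin n) ℕ.* M) ≡⟨ cong (λ k → toℚ (k ℕ.* M)) (length-tabulate {n = n} id) ⟩
    toℚ (n ℕ.* M)               ≡⟨ trans (toℚ-* n M) (*-comm (toℚ n) (toℚ M)) ⟩
    toℚ M * toℚ n               ∎)
    where open ≤-Reasoning

  c*r≤m : ∀ {c m} → toℚ c * toℚ n ≤ toℚ m * κ → c ℕ.* r ℕ.≤ m
  c*r≤m {c} {m} h = toℚ-cancel-≤ (*-cancelʳ-≤-pos κ {{positive (<-≤-trans (positive⁻¹ 1ℚ) 1≤κ)}} (begin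
    toℚ (c ℕ.* r) * κ           ≡⟨ trans (cong (_* κ) (toℚ-* c r)) (*-assoc (toℚ c) (toℚ r) κ) ⟩
    toℚ c * (toℚ r * κ)         ≤⟨ *-monoˡ-≤-nonNeg (toℚ c) {{toℚ-nonNeg c}} rκ≤n ⟩
    toℚ c * toℚ n               ≤⟨ h ⟩
    toℚ m * κ                   ∎))
    where open ≤-Reasoning

  f-spread : ∀ t A → A ∈ H → toℚ (f H t A) * κ ^ t ≤ toℚ (2 ℕ.^ r ℕ.* M)
  f-spread t A A∈H = begin
    toℚ (f H t A) * κ ^ t
      ≤⟨ *-monoʳ-≤-nonNeg (κ ^ t) {{nonNegative (0≤^ 0≤κ t)}} (toℚ-mono-≤ (f≤∑-countSuper H t A)) ⟩
    toℚ (∑ (tSubsetsOf t A) (countSuper H)) * κ ^ t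
      ≤⟨ ∑-scaled (tSubsetsOf t A) (countSuper H) (κ ^ t) M (λ S S∈ →
           subst (λ k → toℚ (countSuper H S) * κ ^ k ≤ toℚ M) (∈-tSubsetsOf {t = t} {A} S∈) (spread S)) ⟩
    toℚ (length (tSubsetsOf t A) ℕ.* M)
      ≤⟨ toℚ-mono-≤ (ℕ.*-monoˡ-≤ M (ℕ.≤-trans (length-tSubsetsOf t A)
           (ℕ.≤-reflexive (cong (2 ℕ.^_) (uniform A A∈H))))) ⟩
    toℚ (2 ℕ.^ r ℕ.* M) ∎
    where open ≤-Reasoning

  module _ {α K₀ : ℚ} {a k : ℕ} (1≤aα : 1ℚ ≤ toℚ a * α) (0≤K₀ : 0ℚ ≤ K₀) (K₀≤k : K₀ ≤ toℚ k)
    (hyp : ∀ A → A ∈ H → (t : ℕ) → 1 ℕ.≤ t → toℚ t ≤ α * toℚ r →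
      toℚ (f H t A) * κ ^ t ≤ K₀ ^ t * toℚ M) where

    private
      -- One base for both ranges of t: `k` covers t ≤ αr because K₀ ≤ k, and 2^a covers t ≥ αr
      -- because r ≤ at there.
      K = 2 ℕ.^ a ℕ.⊔ k

    f-bound-κ : ∀ A → A ∈ H → ∀ t → 1 ℕ.≤ t → toℚ (f H t A) * κ ^ t ≤ toℚ (K ℕ.^ t ℕ.* M)
    f-bound-κ A A∈H t 1≤t = [ small , large ]′ (≤-total (toℚ t) (α * toℚ r))
      where
      small : toℚ t ≤ α * toℚ r → toℚ (f H t A) * κ ^ t ≤ toℚ (K ℕ.^ t ℕ.* M)
      small t≤αr = begin
        toℚ (f H t A) * κ ^ t         ≤⟨ hyp A A∈H t 1≤t t≤αr ⟩
        K₀ ^ t * toℚ M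
          ≤⟨ *-monoʳ-≤-nonNeg (toℚ M) {{toℚ-nonNeg M}} (^-mono-≤ 0≤K₀ (≤-trans K₀≤k (toℚ-mono-≤ (ℕ.m≤n⊔m (2 ℕ.^ a) k))) t) ⟩
        toℚ K ^ t * toℚ M             ≡⟨ cong (_* toℚ M) (sym (toℚ-^ K t)) ⟩
        toℚ (K ℕ.^ t) * toℚ M         ≡⟨ sym (toℚ-* (K ℕ.^ t) M) ⟩
        toℚ (K ℕ.^ t ℕ.* M)           ∎
        where open ≤-Reasoning
      large : α * toℚ r ≤ toℚ t → toℚ (f H t A) * κ ^ t ≤ toℚ (K ℕ.^ t ℕ.* M)
      large αr≤t = ≤-trans (f-spread t A A∈H) (toℚ-mono-≤ (ℕ.*-monoˡ-≤ M (begin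
        2 ℕ.^ r             ≤⟨ ℕ.^-monoʳ-≤ 2 (αr≤t⇒r≤at {α} {a} {r} {t} 1≤aα αr≤t) ⟩
        2 ℕ.^ (a ℕ.* t)     ≡⟨ sym (ℕ.^-*-assoc 2 a t) ⟩
        (2 ℕ.^ a) ℕ.^ t     ≤⟨ ℕ.^-monoˡ-≤ t (ℕ.m≤m⊔n (2 ℕ.^ a) k) ⟩
        K ℕ.^ t             ∎)))
        where open ℕ.≤-Reasoning

    -- This exchanges κ for m without division: f z^t K^t ≤ f (mκ)^t ≤ K^t |H| m^t, and the positive
    -- factor K^t cancels. In the application z is 2nL(e+1).
    f-bound-m : ∀ {z m} → toℚ (z ℕ.* K) ≤ toℚ m * κ →
      ∀ A → A ∈ H → ∀ t → 1 ℕ.≤ t → f H t A ℕ.* z ℕ.^ t ℕ.≤ M ℕ.* m ℕ.^ t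
    f-bound-m {z} {m} zK≤mκ A A∈H t 1≤t = toℚ-cancel-≤ (*-cancelʳ-≤-pos (toℚ (K ℕ.^ t)) {{toℚ-pos K^t>0}} (begin
      toℚ (f H t A ℕ.* z ℕ.^ t) * toℚ (K ℕ.^ t)
        ≡⟨ trans (cong (_* toℚ (K ℕ.^ t)) (toℚ-* (f H t A) (z ℕ.^ t))) (*-assoc (toℚ (f H t A)) _ _) ⟩
      toℚ (f H t A) * (toℚ (z ℕ.^ t) * toℚ (K ℕ.^ t))
        ≡⟨ cong (toℚ (f H t A) *_) (trans (sym (toℚ-* (z ℕ.^ t) (K ℕ.^ t)))
             (trans (cong toℚ (sym (^-distribʳ-* t z K))) (toℚ-^ (z ℕ.* K) t))) ⟩
      toℚ (f H t A) * toℚ (z ℕ.* K) ^ t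
        ≤⟨ *-monoˡ-≤-nonNeg (toℚ (f H t A)) {{toℚ-nonNeg (f H t A)}} (^-mono-≤ (0≤toℚ (z ℕ.* K)) zK≤mκ t) ⟩
      toℚ (f H t A) * (toℚ m * κ) ^ t
        ≡⟨ cong (toℚ (f H t A) *_) (^-*-distrib t (toℚ m) κ) ⟩
      toℚ (f H t A) * (toℚ m ^ t * κ ^ t)
        ≡⟨ solve 3 (λ x y z → x :* (y :* z) := x :* z :* y) refl (toℚ (f H t A)) (toℚ m ^ t) (κ ^ t) ⟩
      toℚ (f H t A) * κ ^ t * toℚ m ^ t
        ≤⟨ *-monoʳ-≤-nonNeg (toℚ m ^ t) {{nonNegative (0≤^ (0≤toℚ m) t)}} (f-bound-κ A A∈H t 1≤t) ⟩
      toℚ (K ℕ.^ t ℕ.* M) * toℚ m ^ t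
        ≡⟨ cong₂ _*_ (toℚ-* (K ℕ.^ t) M) (sym (toℚ-^ m t)) ⟩
      toℚ (K ℕ.^ t) * toℚ M * toℚ (m ℕ.^ t)
        ≡⟨ solve 3 (λ x y z → x :* y :* z := y :* z :* x) refl (toℚ (K ℕ.^ t)) (toℚ M) (toℚ (m ℕ.^ t)) ⟩
      toℚ M * toℚ (m ℕ.^ t) * toℚ (K ℕ.^ t)
        ≡⟨ cong (_* toℚ (K ℕ.^ t)) (sym (toℚ-* M (m ℕ.^ t))) ⟩
      toℚ (M ℕ.* m ℕ.^ t) * toℚ (K ℕ.^ t) ∎))
      where
      open ≤-Reasoning
      K>0 : 0 ℕ.< K
      K>0 = ℕ.<-≤-trans (ℕ.m^n>0 2 a) (ℕ.m≤m⊔n (2 ℕ.^ a) k)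
      K^t>0 : 0 ℕ.< K ℕ.^ t
      K^t>0 = ℕ.m^n>0 K {{ℕ.>-nonZero K>0}} t

ε-bound : ∀ {ε e N G} → 1ℚ ≤ toℚ e * ε → e ℕ.* N ℕ.≤ e ℕ.* G ℕ.+ N → (1ℚ - ε) * toℚ N ≤ toℚ G
-- For `e` = 0 the hypothesis would read 1 ≤ 0.
ε-bound {ε} {zero}  {N} {G} 1≤eε h = contradiction
  (<-≤-trans (positive⁻¹ 1ℚ) (≤-trans 1≤eε (≤-reflexive (*-zeroˡ ε)))) (<-irrefl refl)
ε-bound {ε} {e@(suc _)} {N} {G} 1≤eε h = *-cancelˡ-≤-pos (toℚ e) {{toℚ-pos {e} (ℕ.s≤s ℕ.z≤n)}} (begin
  toℚ e * ((1ℚ - ε) * toℚ N)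
    ≡⟨ solve 3 (λ e x N → e :* ((con 1ℚ :- x) :* N) := e :* N :- e :* x :* N) refl (toℚ e) ε (toℚ N) ⟩
  toℚ e * toℚ N - toℚ e * ε * toℚ N
    ≤⟨ +-mono-≤ (subst₂ _≤_ (toℚ-* e N) (trans (toℚ-+ (e ℕ.* G) N) (cong (_+ toℚ N) (toℚ-* e G))) (toℚ-mono-≤ h))
         (neg-antimono-≤ (*-monoʳ-≤-nonNeg (toℚ N) {{toℚ-nonNeg N}} 1≤eε)) ⟩
  toℚ e * toℚ G + toℚ N - 1ℚ * toℚ N
    ≡⟨ solve 2 (λ x N → x :+ N :- con 1ℚ :* N := x) refl (toℚ e * toℚ G) (toℚ N) ⟩
  toℚ e * toℚ G ∎)
  where open ≤-Reasoning

theorem3 : (α K₀ : ℚ) → 0ℚ < α → α < 1ℚ → 0ℚ < K₀ →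
    (ε ε₁ : ℚ) → 0ℚ < ε → 0ℚ < ε₁ →
    Σ ℚ λ C → 0ℚ < C × (Σ ℕ λ r₀ → Σ ℚ λ κ₀ →
    (r : ℕ) → r₀ ≤ℕ r → (κ : ℚ) → κ₀ ≤ κ →
    (n : ℕ) (H : Hypergraph n) → Unique H → H ≢ [] →
    IsSpread κ H → IsUniform r H → IsEdgeTransitive H →
    (∀ A → A ∈ H → (t : ℕ) → 1 ≤ℕ t → toℚ t ≤ α * toℚ r →
    toℚ (f H t A) * (κ ^ t) ≤ (K₀ ^ t) * toℚ (length H)) →
    (q : ℕ) → (1ℚ + ε₁) * toℚ r ≤ toℚ q →
    (m : ℕ) → m ≤ℕ n → C * toℚ n ≤ toℚ m * κ →
    (1ℚ - ε) * toℚ (totalCount n q m) ≤ toℚ (goodCount H q m))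
theorem3 α K₀ 0<α _ 0<K₀ ε ε₁ 0<ε 0<ε₁ =
  -- The thresholds are r₀ = 1, which gives 0 < m and r < q, and κ₀ = 1, which keeps κ positive.
  toℚ c , positive⁻¹ (toℚ c) {{toℚ-pos 0<c}} , 1 , 1ℚ ,
  λ r 1≤r κ 1≤κ n H _ H≢[] spread uniform _ hyp q q≥ m m≤n Cn≤mκ →
    let palette = palette-bound {ε₁} {l} {r} {q} 1≤lε₁ q≥
        2r≤m    = ℕ.≤-trans (2*≤ r) (c*r≤m 1≤κ H≢[] spread uniform {c} {m} Cn≤mκ)
        zK≤mκ   = ≤-trans (≤-reflexive (trans (cong toℚ (z*K≡c*n n L E K)) (toℚ-* c n))) Cn≤mκ
    in ε-bound {ε} {e} 1≤eε (goodCount-bound n m (n ℕ.∸ m) r q l e H uniform H≢[] (ℕ.m+[n∸m]≡n m≤n)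
         2r≤m (ℕ.≤-trans (ℕ.≤-trans 1≤r (ℕ.m≤m+n r r)) 2r≤m)
         ([1+l]r≤lq⇒r<q l r q 1≤r palette) ([1+l]r≤lq⇒q≤[1+l][q∸r] l r q palette)
         (f-bound-m 1≤κ H≢[] spread uniform {α} {K₀} {a} {k} 1≤aα (<⇒≤ 0<K₀) K₀≤k hyp
           {(n ℕ.+ n) ℕ.* L ℕ.* E} {m} zK≤mκ))
  where
  a k e l L E K c : ℕ
  a = proj₁ (archimedean α 0<α)
  k = proj₁ (upperℕ K₀)
  e = proj₁ (archimedean ε 0<ε)
  l = proj₁ (archimedean ε₁ 0<ε₁)
  L = suc l
  E = suc e
  K = 2 ℕ.^ a ℕ.⊔ k
  -- The 2 comes from `n ℕ.+ n` in the bound for pairs, so that `z` times `K` is exactly c n. It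
  -- also gives c ≥ 2, hence 2r ≤ m by way of rκ ≤ n.
  c = 2 ℕ.* (L ℕ.* E ℕ.* K)
  1≤aα = proj₂ (archimedean α 0<α)
  K₀≤k = proj₂ (upperℕ K₀)
  1≤eε = proj₂ (archimedean ε 0<ε)
  1≤lε₁ = proj₂ (archimedean ε₁ 0<ε₁)
  1≤LEK : 1 ℕ.≤ L ℕ.* E ℕ.* K
  1≤LEK = ℕ.*-mono-≤ {1} {L ℕ.* E} (ℕ.*-mono-≤ {1} {L} (ℕ.s≤s ℕ.z≤n) (ℕ.s≤s ℕ.z≤n))
    (ℕ.≤-trans (ℕ.m^n>0 2 a) (ℕ.m≤m⊔n (2 ℕ.^ a) k))
  0<c : 0 ℕ.< c
  0<c = ℕ.≤-trans (ℕ.s≤s ℕ.z≤n) (ℕ.*-monoʳ-≤ 2 1≤LEK)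
  2*≤ : ∀ r → r ℕ.+ r ℕ.≤ c ℕ.* r
  2*≤ r = ℕ.≤-trans (ℕ.≤-reflexive (cong (r ℕ.+_) (sym (ℕ.+-identityʳ r)))) (ℕ.*-monoˡ-≤ r (ℕ.*-monoʳ-≤ 2 1≤LEK))
  z*K≡c*n : ∀ n L E K → (n ℕ.+ n) ℕ.* L ℕ.* E ℕ.* K ≡ 2 ℕ.* (L ℕ.* E ℕ.* K) ℕ.* n
  z*K≡c*n = solve-∀
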